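{- Let $s,k\in\mathbb{N}$ and let $p\in\mathbb{N}$ with $p\ge k$. For all $n\in\mathbb{N}'$, $$\binom{n+p+1-k}{2p}_{F_s}=(-y)^{spn}\ast\sum_{j=0}^{p-1}\frac{(-y)^{sj(n-k)}F_{2s(p-j)(n+1-k)}}{\mathcal{P}_{2s(p-j)}\,F_{2s(p-j)}}$$ and $$\binom{n+p-k}{2p-1}_{F_s}=\sum_{j=0}^{p-1}\frac{(-y)^{sj(n-k)}F_{s(2p-1-2j)(n+1-k)}}{\mathcal{R}_{s(2p-1-2j)}\,F_{s(2p-1-2j)}},$$ where $\ast$ is convolution of sequences indexed by $n\ge0$ and, for $j=0,1,\dots,p-1$, $$\mathcal{P}_{2s(p-j)}=\prod_{\substack{i=0\\ i\ne j}}^{p-1}\left((-y)^{sj}L_{2s(p-j)}-(-y)^{si}L_{2s(p-i)}\right),$$ $$\mathcal{R}_{s(2p-1-2j)}=\prod_{\substack{i=0\\ i\ne j}}^{p-1}\left((-y)^{sj}L_{s(2p-1-2j)}-(-y)^{si}L_{s(2p-1-2i)}\right).$$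
   Context: $\mathbb{N}=\{1,2,\dots\}$, $\mathbb{N}'=\mathbb{N}\cup\{0\}$. $x,y$ are indeterminates and we abbreviate $F_n=F_n(x,y)$, $L_n=L_n(x,y)$. The bivariate Fibonacci and Lucas polynomials are given by $F_0=0$, $F_1=1$, $F_{n+2}=xF_{n+1}+yF_n$ and $L_0=2$, $L_1=x$, $L_{n+2}=xL_{n+1}+yL_n$, extended to negative indices by $F_{ -n}=-(-y)^{ -n}F_n$, $L_{ -n}=(-y)^{ -n}L_n$ ($n\in\mathbb{N}$). For $n,k\in\mathbb{N}'$ the bivariate $s$-Fibopolynomial is $\binom{n}{k}_{F_s}=\frac{F_{sn}F_{s(n-1)}\cdots F_{s(n-k+1)}}{F_sF_{2s}\cdots F_{ks}}$ (equal to $1$ for $k=0$ and $k=n$, and to $0$ if $k>n$). Convolution: $a_n\ast b_n=\sum_{t=0}^na_tb_{n-t}$, where $a_n,b_n$ denote whole sequences in $n$. Empty products equal $1$. Identities are in $\mathbb{C}(x,y)$. -}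

module Defs where

open import Level using (Level; _⊔_; suc)
open import Algebra.Bundles using (CommutativeRing; Semiring)
open import Algebra.Apartness.Bundles using (HeytingField; HeytingCommutativeRing)
import Algebra.Apartness.Properties.HeytingCommutativeRing as HeytingProperties
import Algebra.Definitions.RawSemiring as RawSemiringDefinitions
import Algebra.Properties.Ring as RingProperties
import Algebra.Solver.Ring.NaturalCoefficients.Default as NaturalCoefficients
open import Data.Bool.Base using (if_then_else_)
open import Data.Fin.Base as Fin using (Fin; toℕ)
open import Data.Fin.Properties as Fin using (toℕ-injective; toℕ<n)
open import Data.Integer.Base as ℤ using (ℤ; -[1+_]) renaming (+_ to pos)
open import Data.List.Base using (List; []; _∷_; map)
open import Data.Nat.Base as ℕ using (ℕ; zero; _∸_; _<_; _≤_; s≤s; NonZero) renaming (suc to 1+)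
import Data.Nat.Properties as ℕ
open import Data.Product.Base using (∃; _×_; _,_; proj₁; proj₂)
open import Data.Sum.Base using (_⊎_; inj₁; inj₂; [_,_]′)
open import Relation.Binary.Definitions using (tri<; tri≈; tri>)
open import Relation.Binary.PropositionalEquality as ≡ using (_≡_; _≢_)
import Relation.Binary.Reasoning.Setoid as SetoidReasoning
open import Relation.Nullary using (¬_; yes; no; does)
open import Relation.Nullary.Negation using (contradiction)

-- The constructive form of an integral domain, to be used between a ground
-- field and its field of rational functions.  The tight apartness is given by
-- its restriction `_#0` to zero: x is apart from y when (x - y) #0.

record ApartnessDomain c ℓ₁ ℓ₂ : Set (suc (c ⊔ ℓ₁ ⊔ ℓ₂)) where
  field
    commutativeRing : CommutativeRing c ℓ₁
  open CommutativeRing commutativeRing public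
  infix 4 _#0
  field
    _#0     : Carrier → Set ℓ₂
    #0-resp : ∀ {x y} → x ≈ y → x #0 → y #0
    ¬0#0    : ¬ (0# #0)
    1#0     : 1# #0
    #0-tight : ∀ {x} → ¬ (x #0) → x ≈ 0#
    +-#0    : ∀ {x y} → (x + y) #0 → x #0 ⊎ y #0
    *-#0    : ∀ {x y} → x #0 → y #0 → (x * y) #0
    *-#0ˡ   : ∀ {x y} → (x * y) #0 → x #0

  open RingProperties ring using (-‿distribˡ-*; -‿involutive)

  *-#0ʳ : ∀ {x y} → (x * y) #0 → y #0
  *-#0ʳ {x} {y} xy#0 = *-#0ˡ (#0-resp (*-comm x y) xy#0)

  -‿#0⁻¹ : ∀ {x} → (- x) #0 → x #0
  -‿#0⁻¹ {x} -x#0 = *-#0ʳ (#0-resp -x≈-1*x -x#0)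
    where
    -x≈-1*x : - x ≈ - 1# * x
    -x≈-1*x = trans (-‿cong (sym (*-identityˡ x))) (-‿distribˡ-* 1# x)

  -‿#0 : ∀ {x} → x #0 → (- x) #0
  -‿#0 x#0 = -‿#0⁻¹ (#0-resp (sym (-‿involutive _)) x#0)

  +-#0-split : ∀ {x y} → x #0 → (x + y) #0 ⊎ y #0
  +-#0-split {x} {y} x#0 with +-#0 (#0-resp x≈x+y-y x#0)
    where
    x≈x+y-y : x ≈ (x + y) + - y
    x≈x+y-y = sym (trans (+-assoc x y (- y)) (trans (+-congˡ (-‿inverseʳ y)) (+-identityʳ x)))
  ... | inj₁ x+y#0 = inj₁ x+y#0
  ... | inj₂ -y#0  = inj₂ (-‿#0⁻¹ -y#0)

  x-y≈0⇒x≈y : ∀ {x y} → x - y ≈ 0# → x ≈ y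
  x-y≈0⇒x≈y {x} {y} eq = begin
    x             ≈⟨ +-identityʳ x ⟨
    x + 0#        ≈⟨ +-congˡ (-‿inverseˡ y) ⟨
    x + (- y + y) ≈⟨ +-assoc x (- y) y ⟨
    (x - y) + y   ≈⟨ +-congʳ eq ⟩
    0# + y        ≈⟨ +-identityˡ y ⟩
    y             ∎
    where open SetoidReasoning setoid

  x≈y⇒x-y≈0 : ∀ {x y} → x ≈ y → x - y ≈ 0#
  x≈y⇒x-y≈0 {x} {y} eq = trans (+-congʳ eq) (-‿inverseʳ y)

  *-cancelˡ : ∀ {z x y} → z #0 → z * x ≈ z * y → x ≈ y
  *-cancelˡ {z} {x} {y} z#0 eq = x-y≈0⇒x≈y (#0-tight λ x-y#0 →
    ¬0#0 (#0-resp z*[x-y]≈0 (*-#0 z#0 x-y#0)))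
    where
    open SetoidReasoning setoid
    z*[x-y]≈0 : z * (x - y) ≈ 0#
    z*[x-y]≈0 = begin
      z * (x - y)       ≈⟨ distribˡ z x (- y) ⟩
      z * x + z * - y   ≈⟨ +-congˡ (RingProperties.-‿distribʳ-* ring z y) ⟨
      z * x - z * y     ≈⟨ x≈y⇒x-y≈0 eq ⟩
      0#                ∎

groundDomain : ∀ {c ℓ₁ ℓ₂} → HeytingField c ℓ₁ ℓ₂ → ApartnessDomain c ℓ₁ ℓ₂
groundDomain K = record
  { commutativeRing = commutativeRing
  ; _#0     = _# 0#
  ; #0-resp = #-congʳ
  ; ¬0#0    = #-irrefl refl
  ; 1#0     = 1#0
  ; #0-tight = λ {x} → proj₁ (tight x 0#)
  ; +-#0    = +-split
  ; *-#0    = x#0y#0→xy#0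
  ; *-#0ˡ   = *-#0ˡ
  }
  where
  open HeytingField K using (_#_; #-irrefl; #-cotrans; #⇒invertible; invertible⇒#; tight; heytingCommutativeRing)
  open HeytingProperties heytingCommutativeRing
  open CommutativeRing (HeytingCommutativeRing.commutativeRing heytingCommutativeRing)
  commutativeRing = HeytingCommutativeRing.commutativeRing heytingCommutativeRing
  open SetoidReasoning setoid

  +-split : ∀ {x y} → (x + y) # 0# → x # 0# ⊎ y # 0#
  +-split {x} {y} x+y#0 with #-cotrans x+y#0 x
  ... | inj₂ x#0   = inj₁ x#0
  ... | inj₁ x+y#x with #⇒invertible x+y#x
  ...   | z , z*[x+y-x]≈1 , _ = inj₂ (invertibleˡ⇒# (z , trans (*-congˡ y-0≈x+y-x) z*[x+y-x]≈1))
    where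
    y-0≈x+y-x : y - 0# ≈ (x + y) - x
    y-0≈x+y-x = begin
      y - 0#      ≈⟨ x-0≈x y ⟩
      y           ≈⟨ +-identityʳ y ⟨
      y + 0#      ≈⟨ +-congˡ (-‿inverseʳ x) ⟨
      y + (x - x) ≈⟨ +-assoc y x (- x) ⟨
      (y + x) - x ≈⟨ +-congʳ (+-comm y x) ⟩
      (x + y) - x ∎

  *-#0ˡ : ∀ {x y} → (x * y) # 0# → x # 0#
  *-#0ˡ {x} {y} xy#0 with #⇒invertible xy#0
  ... | z , _ , [xy-0]*z≈1 = invertibleʳ⇒# (y * z , eq)
    where
    eq : (x - 0#) * (y * z) ≈ 1#
    eq = begin
      (x - 0#) * (y * z) ≈⟨ *-congʳ (x-0≈x x) ⟩
      x * (y * z)        ≈⟨ *-assoc x y z ⟨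
      (x * y) * z        ≈⟨ *-congʳ (x-0≈x (x * y)) ⟨
      (x * y - 0#) * z   ≈⟨ [xy-0]*z≈1 ⟩
      1#                 ∎

-- Univariate polynomials as lists of coefficients, constant term first, up to
-- trailing zeros.

module Polynomials {c ℓ₁ ℓ₂ : Level} (D : ApartnessDomain c ℓ₁ ℓ₂) where
  open ApartnessDomain D
  open SetoidReasoning setoid
  open NaturalCoefficients commutativeSemiring using (solve; _:=_; _:+_; _:*_)

  private
    swap : ∀ w x y z → (w + x) + (y + z) ≈ (w + y) + (x + z)
    swap = solve 4 (λ w x y z → (w :+ x) :+ (y :+ z) := (w :+ y) :+ (x :+ z)) refl

  Poly : Set c
  Poly = List Carrier

  coeff : Poly → ℕ → Carrier
  coeff []      _      = 0#
  coeff (a ∷ p) zero   = a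
  coeff (a ∷ p) (1+ i) = coeff p i

  infix 4 _≈ₚ_
  record _≈ₚ_ (p q : Poly) : Set ℓ₁ where
    constructor coeffwise
    field at : ∀ i → coeff p i ≈ coeff q i
  open _≈ₚ_ public

  infixl 6 _+ₚ_
  infixl 7 _*ₚ_ _·_
  infix  8 -ₚ_

  _+ₚ_ : Poly → Poly → Poly
  []      +ₚ q       = q
  (a ∷ p) +ₚ []      = a ∷ p
  (a ∷ p) +ₚ (b ∷ q) = (a + b) ∷ (p +ₚ q)

  -ₚ_ : Poly → Poly
  -ₚ_ = map (λ a → - a)

  _·_ : Carrier → Poly → Poly
  a · p = map (a *_) p

  _*ₚ_ : Poly → Poly → Poly
  []      *ₚ q = []
  (a ∷ p) *ₚ q = a · q +ₚ (0# ∷ p *ₚ q)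

  const : Carrier → Poly
  const a = a ∷ []

  X : Poly
  X = 0# ∷ 1# ∷ []

  _#0ₚ : Poly → Set ℓ₂
  p #0ₚ = ∃ λ i → coeff p i #0

  coeff-+ : ∀ p q i → coeff (p +ₚ q) i ≈ coeff p i + coeff q i
  coeff-+ []      q       i      = sym (+-identityˡ _)
  coeff-+ (a ∷ p) []      i      = sym (+-identityʳ _)
  coeff-+ (a ∷ p) (b ∷ q) zero   = refl
  coeff-+ (a ∷ p) (b ∷ q) (1+ i) = coeff-+ p q i

  coeff-neg : ∀ p i → coeff (-ₚ p) i ≈ - coeff p i
  coeff-neg []      i      = sym (RingProperties.-0#≈0# ring)
  coeff-neg (a ∷ p) zero   = refl
  coeff-neg (a ∷ p) (1+ i) = coeff-neg p i

  coeff-· : ∀ a p i → coeff (a · p) i ≈ a * coeff p i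
  coeff-· a []      i      = sym (zeroʳ a)
  coeff-· a (b ∷ p) zero   = refl
  coeff-· a (b ∷ p) (1+ i) = coeff-· a p i

  -- The coefficients of a product are the Cauchy product of those of the
  -- factors; the ring laws are proved for arbitrary sequences.

  Seq : Set c
  Seq = ℕ → Carrier

  conv : Seq → Seq → Seq
  conv f g zero   = f 0 * g 0
  conv f g (1+ n) = f 0 * g (1+ n) + conv (λ i → f (1+ i)) g n

  conv-cong : ∀ {f f′ g g′ : Seq} → (∀ i → f i ≈ f′ i) → (∀ i → g i ≈ g′ i) →
              ∀ n → conv f g n ≈ conv f′ g′ n
  conv-cong f≈ g≈ zero   = *-cong (f≈ 0) (g≈ 0)
  conv-cong f≈ g≈ (1+ n) = +-cong (*-cong (f≈ 0) (g≈ (1+ n))) (conv-cong (λ i → f≈ (1+ i)) g≈ n)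

  conv-zeroˡ : ∀ (f g : Seq) → (∀ i → f i ≈ 0#) → ∀ n → conv f g n ≈ 0#
  conv-zeroˡ f g f≈0 zero   = trans (*-congʳ (f≈0 0)) (zeroˡ _)
  conv-zeroˡ f g f≈0 (1+ n) = begin
    f 0 * g (1+ n) + conv (λ i → f (1+ i)) g n
      ≈⟨ +-cong (trans (*-congʳ (f≈0 0)) (zeroˡ _)) (conv-zeroˡ _ g (λ i → f≈0 (1+ i)) n) ⟩
    0# + 0#
      ≈⟨ +-identityˡ 0# ⟩
    0# ∎

  conv-constˡ : ∀ (f g : Seq) → (∀ i → f (1+ i) ≈ 0#) → ∀ n → conv f g n ≈ f 0 * g n
  conv-constˡ f g f≈0 zero   = refl
  conv-constˡ f g f≈0 (1+ n) = trans (+-congˡ (conv-zeroˡ _ g f≈0 n)) (+-identityʳ _)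

  conv-lastʳ : ∀ (f g : Seq) n → conv f g (1+ n) ≈ f (1+ n) * g 0 + conv f (λ i → g (1+ i)) n
  conv-lastʳ f g zero   = +-comm _ _
  conv-lastʳ f g (1+ n) = begin
    f 0 * g (2 ℕ.+ n) + conv (λ i → f (1+ i)) g (1+ n)
      ≈⟨ +-congˡ (conv-lastʳ (λ i → f (1+ i)) g n) ⟩
    f 0 * g (2 ℕ.+ n) + (f (2 ℕ.+ n) * g 0 + conv (λ i → f (1+ i)) (λ i → g (1+ i)) n)
      ≈⟨ rotate (f 0 * g (2 ℕ.+ n)) (f (2 ℕ.+ n) * g 0) _ ⟩
    f (2 ℕ.+ n) * g 0 + (f 0 * g (2 ℕ.+ n) + conv (λ i → f (1+ i)) (λ i → g (1+ i)) n) ∎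
    where
    rotate : ∀ a b d → a + (b + d) ≈ b + (a + d)
    rotate = solve 3 (λ a b d → a :+ (b :+ d) := b :+ (a :+ d)) refl

  conv-comm : ∀ (f g : Seq) n → conv f g n ≈ conv g f n
  conv-comm f g zero   = *-comm _ _
  conv-comm f g (1+ n) = begin
    f 0 * g (1+ n) + conv (λ i → f (1+ i)) g n ≈⟨ +-cong (*-comm _ _) (conv-comm (λ i → f (1+ i)) g n) ⟩
    g (1+ n) * f 0 + conv g (λ i → f (1+ i)) n ≈⟨ conv-lastʳ g f n ⟨
    conv g f (1+ n) ∎

  conv-+ˡ : ∀ (f g h : Seq) n → conv (λ i → f i + g i) h n ≈ conv f h n + conv g h n
  conv-+ˡ f g h zero   = distribʳ _ _ _
  conv-+ˡ f g h (1+ n) = trans (+-cong (distribʳ _ _ _) (conv-+ˡ _ _ h n)) (swap _ _ _ _)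

  conv-·ˡ : ∀ a (f g : Seq) n → conv (λ i → a * f i) g n ≈ a * conv f g n
  conv-·ˡ a f g zero   = *-assoc _ _ _
  conv-·ˡ a f g (1+ n) = trans (+-cong (*-assoc _ _ _) (conv-·ˡ a _ g n)) (sym (distribˡ _ _ _))

  conv-assoc : ∀ (f g h : Seq) n → conv (conv f g) h n ≈ conv f (conv g h) n
  conv-assoc f g h zero   = *-assoc _ _ _
  conv-assoc f g h (1+ n) = begin
    (f 0 * g 0) * h (1+ n) + conv (λ i → f 0 * g (1+ i) + conv f′ g i) h n
      ≈⟨ +-cong (*-assoc _ _ _) (trans (conv-+ˡ _ _ h n)
           (+-cong (conv-·ˡ (f 0) g′ h n) (conv-assoc f′ g h n))) ⟩
    f 0 * (g 0 * h (1+ n)) + (f 0 * conv g′ h n + conv f′ (conv g h) n)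
      ≈⟨ +-assoc _ _ _ ⟨
    (f 0 * (g 0 * h (1+ n)) + f 0 * conv g′ h n) + conv f′ (conv g h) n
      ≈⟨ +-congʳ (distribˡ _ _ _) ⟨
    f 0 * (g 0 * h (1+ n) + conv g′ h n) + conv f′ (conv g h) n ∎
    where
    f′ g′ : Seq
    f′ i = f (1+ i)
    g′ i = g (1+ i)

  coeff-* : ∀ p q i → coeff (p *ₚ q) i ≈ conv (coeff p) (coeff q) i
  coeff-* []      q i = sym (conv-zeroˡ (λ _ → 0#) (coeff q) (λ _ → refl) i)
  coeff-* (a ∷ p) q zero = begin
    coeff (a · q +ₚ (0# ∷ p *ₚ q)) 0 ≈⟨ coeff-+ (a · q) _ 0 ⟩
    coeff (a · q) 0 + 0#             ≈⟨ +-identityʳ _ ⟩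
    coeff (a · q) 0                  ≈⟨ coeff-· a q 0 ⟩
    a * coeff q 0                    ∎
  coeff-* (a ∷ p) q (1+ i) =
    trans (coeff-+ (a · q) _ (1+ i)) (+-cong (coeff-· a q (1+ i)) (coeff-* p q i))

  conv-#0⁻¹ : ∀ (f g : Seq) n → conv f g n #0 → ∃ λ i → f i #0
  conv-#0⁻¹ f g zero   fg#0 = 0 , *-#0ˡ fg#0
  conv-#0⁻¹ f g (1+ n) fg#0 with +-#0 fg#0
  ... | inj₁ f₀g#0 = 0 , *-#0ˡ f₀g#0
  ... | inj₂ f′g#0 with conv-#0⁻¹ (λ i → f (1+ i)) g n f′g#0
  ...   | i , fᵢ#0 = 1+ i , fᵢ#0

  conv-#0₀ : ∀ (f g : Seq) j → f 0 #0 → g j #0 → ∃ λ n → conv f g n #0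
  conv-#0₀ f g zero   f₀#0 gⱼ#0 = 0 , *-#0 f₀#0 gⱼ#0
  conv-#0₀ f g (1+ j) f₀#0 gⱼ#0 with conv-#0₀ f (λ i → g (1+ i)) j f₀#0 gⱼ#0
  ... | n , fg′#0 with +-#0-split fg′#0
  ...   | inj₁ s#0   = 1+ n , #0-resp (trans (+-comm _ _) (sym (conv-lastʳ f g n))) s#0
  ...   | inj₂ fg₀#0 = 0 , *-#0 f₀#0 (*-#0ʳ {f (1+ n)} fg₀#0)

  conv-#0 : ∀ (f g : Seq) i j → f i #0 → g j #0 → ∃ λ n → conv f g n #0
  conv-#0 f g zero   j fᵢ#0 gⱼ#0 = conv-#0₀ f g j fᵢ#0 gⱼ#0
  conv-#0 f g (1+ i) j fᵢ#0 gⱼ#0 with conv-#0 (λ i → f (1+ i)) g i j fᵢ#0 gⱼ#0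
  ... | n , f′g#0 with +-#0-split f′g#0
  ...   | inj₁ s#0   = 1+ n , #0-resp (+-comm _ _) s#0
  ...   | inj₂ f₀g#0 = conv-#0₀ f g j (*-#0ˡ f₀g#0) gⱼ#0

  polynomialRing : CommutativeRing c ℓ₁
  polynomialRing = record
    { Carrier = Poly
    ; _≈_ = _≈ₚ_
    ; _+_ = _+ₚ_
    ; _*_ = _*ₚ_
    ; -_  = -ₚ_
    ; 0#  = []
    ; 1#  = const 1#
    ; isCommutativeRing = record
      { isRing = record
        { +-isAbelianGroup = record
          { isGroup = record
            { isMonoid = record
              { isSemigroup = record
                { isMagma = record
                  { isEquivalence = record
                    { refl  = coeffwise λ _ → refl
                    ; sym   = λ p≈q → coeffwise λ i → sym (at p≈q i)
                    ; trans = ≈ₚ-trans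
                    }
                  ; ∙-cong = λ {p} {p′} {q} {q′} p≈p′ q≈q′ → coeffwise λ i →
                      trans (coeff-+ p q i) (trans (+-cong (at p≈p′ i) (at q≈q′ i)) (sym (coeff-+ p′ q′ i)))
                  }
                ; assoc = λ p q r → coeffwise λ i →
                    trans (coeff-+ (p +ₚ q) r i) (trans (+-congʳ (coeff-+ p q i)) (trans (+-assoc _ _ _)
                      (sym (trans (coeff-+ p (q +ₚ r) i) (+-congˡ (coeff-+ q r i))))))
                }
              ; identity = (λ p → coeffwise λ i → refl)
                         , (λ p → coeffwise λ i → trans (coeff-+ p [] i) (+-identityʳ _))
              }
            ; inverse = (λ p → coeffwise λ i →
                           trans (coeff-+ (-ₚ p) p i) (trans (+-congʳ (coeff-neg p i)) (-‿inverseˡ _)))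
                      , (λ p → coeffwise λ i →
                           trans (coeff-+ p (-ₚ p) i) (trans (+-congˡ (coeff-neg p i)) (-‿inverseʳ _)))
            ; ⁻¹-cong = λ {p} {q} p≈q → coeffwise λ i →
                trans (coeff-neg p i) (trans (-‿cong (at p≈q i)) (sym (coeff-neg q i)))
            }
          ; comm = λ p q → coeffwise λ i →
              trans (coeff-+ p q i) (trans (+-comm _ _) (sym (coeff-+ q p i)))
          }
        ; *-cong = λ {p} {p′} {q} {q′} p≈p′ q≈q′ → coeffwise λ i →
            trans (coeff-* p q i) (trans (conv-cong (at p≈p′) (at q≈q′) i) (sym (coeff-* p′ q′ i)))
        ; *-assoc = λ p q r → coeffwise λ i →
            trans (coeff-* (p *ₚ q) r i) (trans (conv-cong (coeff-* p q) (λ _ → refl) i)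
              (trans (conv-assoc (coeff p) (coeff q) (coeff r) i)
                (sym (trans (coeff-* p (q *ₚ r) i) (conv-cong {coeff p} (λ _ → refl) (coeff-* q r) i)))))
        ; *-identity = *ₚ-identityˡ , (λ p → ≈ₚ-trans (*ₚ-comm p (const 1#)) (*ₚ-identityˡ p))
        ; distrib = (λ p q r → ≈ₚ-trans (*ₚ-comm p (q +ₚ r)) (≈ₚ-trans (*ₚ-distribʳ p q r)
                       (coeffwise λ i → trans (coeff-+ (q *ₚ p) (r *ₚ p) i)
                         (trans (+-cong (at (*ₚ-comm q p) i) (at (*ₚ-comm r p) i))
                           (sym (coeff-+ (p *ₚ q) (p *ₚ r) i))))))
                  , *ₚ-distribʳ
        }
      ; *-comm = *ₚ-comm
      }
    }
    where
    ≈ₚ-trans : ∀ {p q r} → p ≈ₚ q → q ≈ₚ r → p ≈ₚ r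
    ≈ₚ-trans p≈q q≈r = coeffwise λ i → trans (at p≈q i) (at q≈r i)

    *ₚ-comm : ∀ p q → p *ₚ q ≈ₚ q *ₚ p
    *ₚ-comm p q = coeffwise λ i →
      trans (coeff-* p q i) (trans (conv-comm (coeff p) (coeff q) i) (sym (coeff-* q p i)))

    *ₚ-identityˡ : ∀ p → const 1# *ₚ p ≈ₚ p
    *ₚ-identityˡ p = coeffwise λ i →
      trans (coeff-* (const 1#) p i)
        (trans (conv-constˡ (coeff (const 1#)) (coeff p) (λ _ → refl) i) (*-identityˡ _))

    *ₚ-distribʳ : ∀ p q r → (q +ₚ r) *ₚ p ≈ₚ q *ₚ p +ₚ r *ₚ p
    *ₚ-distribʳ p q r = coeffwise λ i →
      trans (coeff-* (q +ₚ r) p i) (trans (conv-cong {g = coeff p} (coeff-+ q r) (λ _ → refl) i)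
        (trans (conv-+ˡ (coeff q) (coeff r) (coeff p) i)
          (sym (trans (coeff-+ (q *ₚ p) (r *ₚ p) i) (+-cong (coeff-* q p i) (coeff-* r p i))))))

  polynomialDomain : ApartnessDomain c ℓ₁ ℓ₂
  polynomialDomain = record
    { commutativeRing = polynomialRing
    ; _#0     = _#0ₚ
    ; #0-resp = λ { p≈q (i , pᵢ#0) → i , #0-resp (at p≈q i) pᵢ#0 }
    ; ¬0#0    = λ { (_ , 0#0) → ¬0#0 0#0 }
    ; 1#0     = 0 , 1#0
    ; #0-tight = λ ¬p#0 → coeffwise λ i → #0-tight λ pᵢ#0 → ¬p#0 (i , pᵢ#0)
    ; +-#0    = λ { {p} {q} (i , p+qᵢ#0) →
        [ (λ pᵢ#0 → inj₁ (i , pᵢ#0)) , (λ qᵢ#0 → inj₂ (i , qᵢ#0)) ]′ (+-#0 (#0-resp (coeff-+ p q i) p+qᵢ#0)) }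
    ; *-#0    = λ { {p} {q} (i , pᵢ#0) (j , qⱼ#0) → *ₚ-#0 p q (conv-#0 (coeff p) (coeff q) i j pᵢ#0 qⱼ#0) }
    ; *-#0ˡ   = λ { {p} {q} (n , pq#0) → conv-#0⁻¹ (coeff p) (coeff q) n (#0-resp (coeff-* p q n) pq#0) }
    }
    where
    *ₚ-#0 : ∀ p q → (∃ λ n → conv (coeff p) (coeff q) n #0) → (p *ₚ q) #0ₚ
    *ₚ-#0 p q (n , pq#0) = n , #0-resp (sym (coeff-* p q n)) pq#0

  coeff-const-* : ∀ a p i → coeff (const a *ₚ p) i ≈ a * coeff p i
  coeff-const-* a p i = trans (coeff-* (const a) p i) (conv-constˡ (coeff (const a)) (coeff p) (λ _ → refl) i)

  coeff-X-* : ∀ p i → coeff (X *ₚ p) (1+ i) ≈ coeff p i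
  coeff-X-* p i = begin
    coeff (X *ₚ p) (1+ i)                                ≈⟨ coeff-* X p (1+ i) ⟩
    0# * coeff p (1+ i) + conv (coeff (const 1#)) (coeff p) i
      ≈⟨ +-cong (zeroˡ _) (conv-constˡ (coeff (const 1#)) (coeff p) (λ _ → refl) i) ⟩
    0# + 1# * coeff p i                                  ≈⟨ trans (+-identityˡ _) (*-identityˡ _) ⟩
    coeff p i                                            ∎

module Fractions {c ℓ₁ ℓ₂ : Level} (D : ApartnessDomain c ℓ₁ ℓ₂) where
  open ApartnessDomain D
  open SetoidReasoning setoid
  open NaturalCoefficients commutativeSemiring using (solve; _:=_; _:+_; _:*_)

  -- Without eta, comparing fractions does not unfold numerators and
  -- denominators.
  record Fraction : Set (c ⊔ ℓ₂) where
    no-eta-equality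
    pattern
    constructor fraction
    field
      num   : Carrier
      den   : Carrier
      den#0 : den #0
  open Fraction public

  infix 4 _≈f_ _#f_
  record _≈f_ (f g : Fraction) : Set ℓ₁ where
    constructor cross
    field uncross : num f * den g ≈ num g * den f
  open _≈f_ public

  record _#f_ (f g : Fraction) : Set ℓ₂ where
    constructor cross#
    field uncross# : (num f * den g - num g * den f) #0
  open _#f_ public

  infixl 6 _+f_
  infixl 7 _*f_
  infix  8 -f_

  _+f_ : Fraction → Fraction → Fraction
  fraction a b b#0 +f fraction c d d#0 = fraction (a * d + c * b) (b * d) (*-#0 b#0 d#0)

  _*f_ : Fraction → Fraction → Fraction
  fraction a b b#0 *f fraction c d d#0 = fraction (a * c) (b * d) (*-#0 b#0 d#0)

  -f_ : Fraction → Fraction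
  -f fraction a b b#0 = fraction (- a) b b#0

  ι : Carrier → Fraction
  ι a = fraction a 1# 1#0

  private
    ≈f-refl : ∀ {f} → f ≈f f
    ≈f-refl = cross refl

    ≈f-sym : ∀ {f g} → f ≈f g → g ≈f f
    ≈f-sym (cross e) = cross (sym e)

    ≈f-trans : ∀ {f g h} → f ≈f g → g ≈f h → f ≈f h
    ≈f-trans {fraction a b _} {fraction c d d#0} {fraction e f _} (cross ad≈cb) (cross cf≈ed) =
      cross (*-cancelˡ d#0 (begin
        d * (a * f) ≈⟨ l₁ a d f ⟩
        (a * d) * f ≈⟨ *-congʳ ad≈cb ⟩
        (c * b) * f ≈⟨ l₂ c b f ⟩
        (c * f) * b ≈⟨ *-congʳ cf≈ed ⟩
        (e * d) * b ≈⟨ l₃ e d b ⟩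
        d * (e * b) ∎))
      where
      l₁ : ∀ a d f → d * (a * f) ≈ (a * d) * f
      l₁ = solve 3 (λ a d f → d :* (a :* f) := (a :* d) :* f) refl
      l₂ : ∀ c b f → (c * b) * f ≈ (c * f) * b
      l₂ = solve 3 (λ c b f → (c :* b) :* f := (c :* f) :* b) refl
      l₃ : ∀ e d b → (e * d) * b ≈ d * (e * b)
      l₃ = solve 3 (λ e d b → (e :* d) :* b := d :* (e :* b)) refl

    +f-cong : ∀ {f f′ g g′} → f ≈f f′ → g ≈f g′ → f +f g ≈f f′ +f g′
    +f-cong {fraction a b _} {fraction a′ b′ _} {fraction c d _} {fraction c′ d′ _} (cross e) (cross e′) =
      cross (begin
        (a * d + c * b) * (b′ * d′)               ≈⟨ l a b c d b′ d′ ⟩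
        (a * b′) * (d * d′) + (c * d′) * (b * b′) ≈⟨ +-cong (*-congʳ e) (*-congʳ e′) ⟩
        (a′ * b) * (d * d′) + (c′ * d) * (b * b′) ≈⟨ r b d a′ b′ c′ d′ ⟩
        (a′ * d′ + c′ * b′) * (b * d)             ∎)
      where
      l : ∀ a b c d b′ d′ → (a * d + c * b) * (b′ * d′) ≈ (a * b′) * (d * d′) + (c * d′) * (b * b′)
      l = solve 6 (λ a b c d b′ d′ → (a :* d :+ c :* b) :* (b′ :* d′) := (a :* b′) :* (d :* d′) :+ (c :* d′) :* (b :* b′)) refl
      r : ∀ b d a′ b′ c′ d′ → (a′ * b) * (d * d′) + (c′ * d) * (b * b′) ≈ (a′ * d′ + c′ * b′) * (b * d)
      r = solve 6 (λ b d a′ b′ c′ d′ → (a′ :* b) :* (d :* d′) :+ (c′ :* d) :* (b :* b′) := (a′ :* d′ :+ c′ :* b′) :* (b :* d)) refl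

    *f-cong : ∀ {f f′ g g′} → f ≈f f′ → g ≈f g′ → f *f g ≈f f′ *f g′
    *f-cong {fraction a b _} {fraction a′ b′ _} {fraction c d _} {fraction c′ d′ _} (cross e) (cross e′) =
      cross (begin
        (a * c) * (b′ * d′)   ≈⟨ l a c b′ d′ ⟩
        (a * b′) * (c * d′)   ≈⟨ *-cong e e′ ⟩
        (a′ * b) * (c′ * d)   ≈⟨ l a′ b c′ d ⟩
        (a′ * c′) * (b * d)   ∎)
      where
      l : ∀ w x y z → (w * x) * (y * z) ≈ (w * y) * (x * z)
      l = solve 4 (λ w x y z → (w :* x) :* (y :* z) := (w :* y) :* (x :* z)) refl

    -f-cong : ∀ {f g} → f ≈f g → -f f ≈f -f g
    -f-cong {fraction a b _} {fraction c d _} (cross e) = cross (begin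
      - a * d   ≈⟨ -‿distribˡ-* a d ⟨
      - (a * d) ≈⟨ -‿cong e ⟩
      - (c * b) ≈⟨ -‿distribˡ-* c b ⟩
      - c * b   ∎)
      where open RingProperties ring

    +f-assoc : ∀ f g h → (f +f g) +f h ≈f f +f (g +f h)
    +f-assoc (fraction a b _) (fraction c d _) (fraction e f _) = cross (l a b c d e f)
      where
      l : ∀ a b c d e f →
          ((a * d + c * b) * f + e * (b * d)) * (b * (d * f)) ≈ (a * (d * f) + (c * f + e * d) * b) * ((b * d) * f)
      l = solve 6 (λ a b c d e f → ((a :* d :+ c :* b) :* f :+ e :* (b :* d)) :* (b :* (d :* f)) := (a :* (d :* f) :+ (c :* f :+ e :* d) :* b) :* ((b :* d) :* f)) refl

    +f-comm : ∀ f g → f +f g ≈f g +f f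
    +f-comm (fraction a b _) (fraction c d _) = cross (l a b c d)
      where
      l : ∀ a b c d → (a * d + c * b) * (d * b) ≈ (c * b + a * d) * (b * d)
      l = solve 4 (λ a b c d → (a :* d :+ c :* b) :* (d :* b) := (c :* b :+ a :* d) :* (b :* d)) refl

    +f-identityˡ : ∀ f → ι 0# +f f ≈f f
    +f-identityˡ (fraction a b _) = cross (begin
      (0# * b + a * 1#) * b ≈⟨ *-congʳ (+-cong (zeroˡ b) refl) ⟩
      (0# + a * 1#) * b     ≈⟨ *-congʳ (+-identityˡ _) ⟩
      (a * 1#) * b          ≈⟨ *-assoc a 1# b ⟩
      a * (1# * b)          ∎)

    -f-inverseˡ : ∀ f → -f f +f f ≈f ι 0#
    -f-inverseˡ (fraction a b _) = cross (begin
      (- a * b + a * b) * 1# ≈⟨ *-identityʳ _ ⟩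
      - a * b + a * b        ≈⟨ distribʳ b (- a) a ⟨
      (- a + a) * b          ≈⟨ *-congʳ (-‿inverseˡ a) ⟩
      0# * b                 ≈⟨ trans (zeroˡ b) (sym (zeroˡ (b * b))) ⟩
      0# * (b * b)           ∎)

    *f-assoc : ∀ f g h → (f *f g) *f h ≈f f *f (g *f h)
    *f-assoc (fraction a b _) (fraction c d _) (fraction e f _) = cross (l a b c d e f)
      where
      l : ∀ a b c d e f → ((a * c) * e) * (b * (d * f)) ≈ (a * (c * e)) * ((b * d) * f)
      l = solve 6 (λ a b c d e f → ((a :* c) :* e) :* (b :* (d :* f)) := (a :* (c :* e)) :* ((b :* d) :* f)) refl

    *f-comm : ∀ f g → f *f g ≈f g *f f
    *f-comm (fraction a b _) (fraction c d _) = cross (*-cong (*-comm a c) (*-comm d b))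

    *f-identityˡ : ∀ f → ι 1# *f f ≈f f
    *f-identityˡ (fraction a b _) = cross (trans (*-congʳ (*-identityˡ a)) (*-congˡ (sym (*-identityˡ b))))

    *f-distribʳ : ∀ f g h → (g +f h) *f f ≈f g *f f +f h *f f
    *f-distribʳ (fraction a b _) (fraction c d _) (fraction e f _) = cross (l a b c d e f)
      where
      l : ∀ a b c d e f →
          ((c * f + e * d) * a) * ((d * b) * (f * b)) ≈ ((c * a) * (f * b) + (e * a) * (d * b)) * ((d * f) * b)
      l = solve 6 (λ a b c d e f → ((c :* f :+ e :* d) :* a) :* ((d :* b) :* (f :* b)) := ((c :* a) :* (f :* b) :+ (e :* a) :* (d :* b)) :* ((d :* f) :* b)) refl

  fractionRing : CommutativeRing (c ⊔ ℓ₂) ℓ₁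
  fractionRing = record
    { Carrier = Fraction
    ; _≈_ = _≈f_
    ; _+_ = _+f_
    ; _*_ = _*f_
    ; -_  = -f_
    ; 0#  = ι 0#
    ; 1#  = ι 1#
    ; isCommutativeRing = record
      { isRing = record
        { +-isAbelianGroup = record
          { isGroup = record
            { isMonoid = record
              { isSemigroup = record
                { isMagma = record
                  { isEquivalence = record { refl = ≈f-refl ; sym = ≈f-sym ; trans = ≈f-trans }
                  ; ∙-cong = +f-cong
                  }
                ; assoc = +f-assoc
                }
              ; identity = +f-identityˡ , (λ f → ≈f-trans (+f-comm f (ι 0#)) (+f-identityˡ f))
              }
            ; inverse = -f-inverseˡ , (λ f → ≈f-trans (+f-comm f (-f f)) (-f-inverseˡ f))
            ; ⁻¹-cong = -f-cong
            }
          ; comm = +f-comm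
          }
        ; *-cong = *f-cong
        ; *-assoc = *f-assoc
        ; *-identity = *f-identityˡ , (λ f → ≈f-trans (*f-comm f (ι 1#)) (*f-identityˡ f))
        ; distrib = (λ f g h → ≈f-trans (*f-comm f (g +f h)) (≈f-trans (*f-distribʳ f g h)
                                 (+f-cong (*f-comm g f) (*f-comm h f))))
                  , *f-distribʳ
        }
      ; *-comm = *f-comm
      }
    }

  private
    sub-swap : ∀ a b → - (a - b) ≈ b - a
    sub-swap a b = trans (RingProperties.-‿anti-homo-+ ring a (- b)) (+-congʳ (RingProperties.-‿involutive ring b))

    #f-cotrans : ∀ {f g} → f #f g → ∀ h → f #f h ⊎ h #f g
    #f-cotrans {fraction a b b#0} {fraction c d d#0} (cross# ad-cb#0) (fraction e f f#0) =
      [ (λ z → inj₁ (cross# (*-#0ʳ z))) , (λ z → inj₂ (cross# (*-#0ʳ z))) ]′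
        (+-#0 {d * (a * f - e * b)} {b * (e * d - c * f)} (#0-resp eq (*-#0 f#0 ad-cb#0)))
      where
      open RingProperties ring using (x[y-z]≈xy-xz)
      telescope : ∀ u v w → u - w ≈ (u - v) + (v - w)
      telescope u v w = begin
        u - w               ≈⟨ +-congʳ (+-identityʳ u) ⟨
        (u + 0#) - w        ≈⟨ +-congʳ (+-congˡ (-‿inverseˡ v)) ⟨
        (u + (- v + v)) - w ≈⟨ +-congʳ (+-assoc u (- v) v) ⟨
        ((u - v) + v) - w   ≈⟨ +-assoc (u - v) v (- w) ⟩
        (u - v) + (v - w)   ∎
      l : ∀ w x y → w * (x * y) ≈ y * (x * w)
      l = solve 3 (λ w x y → w :* (x :* y) := y :* (x :* w)) refl
      eq : f * (a * d - c * b) ≈ d * (a * f - e * b) + b * (e * d - c * f)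
      eq = begin
        f * (a * d - c * b)
          ≈⟨ x[y-z]≈xy-xz f _ _ ⟩
        f * (a * d) - f * (c * b)
          ≈⟨ +-cong (l f a d) (-‿cong (l f c b)) ⟩
        d * (a * f) - b * (c * f)
          ≈⟨ telescope _ (d * (e * b)) _ ⟩
        (d * (a * f) - d * (e * b)) + (d * (e * b) - b * (c * f))
          ≈⟨ +-cong (x[y-z]≈xy-xz d _ _) (trans (x[y-z]≈xy-xz b _ _) (+-congʳ (l b e d))) ⟨
        d * (a * f - e * b) + b * (e * d - c * f) ∎

    num-sub : ∀ a b c d → a * d + - c * b ≈ a * d - c * b
    num-sub a b c d = +-congˡ (sym (RingProperties.-‿distribˡ-* ring c b))

  fractionField : HeytingField (c ⊔ ℓ₂) ℓ₁ ℓ₂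
  fractionField = record
    { Carrier = Fraction
    ; _≈_ = _≈f_
    ; _#_ = _#f_
    ; _+_ = _+f_
    ; _*_ = _*f_
    ; -_  = -f_
    ; 0#  = ι 0#
    ; 1#  = ι 1#
    ; isHeytingField = record
      { isHeytingCommutativeRing = record
        { isCommutativeRing = CommutativeRing.isCommutativeRing fractionRing
        ; isApartnessRelation = record
          { irrefl  = λ { (cross e) (cross# e#0) → ¬0#0 (#0-resp (x≈y⇒x-y≈0 e) e#0) }
          ; sym     = λ { (cross# e#0) → cross# (#0-resp (sub-swap _ _) (-‿#0 e#0)) }
          ; cotrans = #f-cotrans
          }
        ; #⇒invertible = λ {f} {g} → invert f g
        ; invertible⇒# = λ {f} {g} → separate f g
        }
      ; tight = λ f g → (λ ¬f#g → cross (x-y≈0⇒x≈y (#0-tight λ e#0 → ¬f#g (cross# e#0))))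
                      , (λ { (cross e) (cross# e#0) → ¬0#0 (#0-resp (x≈y⇒x-y≈0 e) e#0) })
      }
    }
    where
    invert : ∀ f g → f #f g → ∃ λ h → (h *f (f +f -f g) ≈f ι 1#) × ((f +f -f g) *f h ≈f ι 1#)
    invert (fraction a b b#0) (fraction c d d#0) (cross# e#0) =
      fraction (b * d) u (#0-resp (sym (num-sub a b c d)) e#0) , cross (unit (b * d) u) , cross (unit u (b * d))
      where
      u : Carrier
      u = a * d + - c * b
      unit : ∀ v w → (v * w) * 1# ≈ 1# * (w * v)
      unit v w = trans (*-identityʳ (v * w)) (trans (*-comm v w) (sym (*-identityˡ (w * v))))

    separate : ∀ f g → (∃ λ h → (h *f (f +f -f g) ≈f ι 1#) × ((f +f -f g) *f h ≈f ι 1#)) → f #f g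
    separate (fraction a b b#0) (fraction c d d#0) (fraction v w w#0 , _ , cross e) =
      cross# (#0-resp (num-sub a b c d) (*-#0ˡ {a * d + - c * b} {v} (*-#0ˡ {y = 1#} (#0-resp (sym e)
        (*-#0 1#0 (*-#0 (*-#0 b#0 d#0) w#0))))))

module FibonacciLucas {c ℓ₁ ℓ₂ : Level} (𝔽 : HeytingField c ℓ₁ ℓ₂) where
  open HeytingField 𝔽 using (_#_; #⇒invertible; heytingCommutativeRing) public
  open CommutativeRing (HeytingCommutativeRing.commutativeRing heytingCommutativeRing) public
  open RawSemiringDefinitions (Semiring.rawSemiring semiring) using (_^_; sum; product) public

  infixl 7 _/_[_]
  infixl 5 _∗_
  infix  5 ∑ ∏

  -- #⇒invertible inverts a - 0#, which equals a.
  inv : ∀ a → a # 0# → Carrier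
  inv a a#0 = proj₁ (#⇒invertible a#0)

  _/_[_] : Carrier → ∀ b → b # 0# → Carrier
  a / b [ b#0 ] = a * inv b b#0

  ∑ ∏ : ∀ n → (Fin n → Carrier) → Carrier
  ∑ n f = sum {n} f
  ∏ n f = product {n} f

  syntax ∑ n (λ i → e) = ∑[ i < n ] e
  syntax ∏ n (λ i → e) = ∏[ i < n ] e

  ∏-except : ∀ {n} → Fin n → (Fin n → Carrier) → Carrier
  ∏-except {n} j f = ∏[ i < n ] (if does (i Fin.≟ j) then 1# else f i)

  _∗_ : (ℕ → Carrier) → (ℕ → Carrier) → ℕ → Carrier
  (a ∗ b) n = ∑[ t < 1+ n ] (a (toℕ t) * b (n ∸ toℕ t))

  module Sequences (x y : Carrier) (-y#0 : (- y) # 0#) where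

    fib : ℕ → Carrier
    fib zero          = 0#
    fib (1+ zero)     = 1#
    fib (1+ (1+ n))   = x * fib (1+ n) + y * fib n

    lucas : ℕ → Carrier
    lucas zero        = 1# + 1#
    lucas (1+ zero)   = x
    lucas (1+ (1+ n)) = x * lucas (1+ n) + y * lucas n

    infixr 8 [-y]^_

    [-y]^_ : ℤ → Carrier
    [-y]^ pos n    = (- y) ^ n
    [-y]^ -[1+ n ] = inv (- y) -y#0 ^ 1+ n

    F L : ℤ → Carrier
    F (pos n)    = fib n
    F (-[1+ n ]) = - ([-y]^ -[1+ n ] * fib (1+ n))
    L (pos n)    = lucas n
    L (-[1+ n ]) = [-y]^ -[1+ n ] * lucas (1+ n)

    -- Indexed by j rather than by the subscript of L.
    𝒫 ℛ : ∀ s p → Fin p → Carrier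
    𝒫 s p j = ∏-except j λ i →
        [-y]^ pos (s ℕ.* toℕ j) * L (pos (2 ℕ.* s ℕ.* (p ∸ toℕ j)))
      - [-y]^ pos (s ℕ.* toℕ i) * L (pos (2 ℕ.* s ℕ.* (p ∸ toℕ i)))
    ℛ s p j = ∏-except j λ i →
        [-y]^ pos (s ℕ.* toℕ j) * L (pos (s ℕ.* (2 ℕ.* p ∸ 1 ∸ 2 ℕ.* toℕ j)))
      - [-y]^ pos (s ℕ.* toℕ i) * L (pos (s ℕ.* (2 ℕ.* p ∸ 1 ∸ 2 ℕ.* toℕ i)))

-- The fraction field of D[x] with a distinguished y ∈ D; below D is K[y].  The
-- denominators in question are nonzero because of their degrees in x.

module FractionFieldOfPolynomials
  {c ℓ₁ ℓ₂ : Level} (D : ApartnessDomain c ℓ₁ ℓ₂)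
  (y₀ : ApartnessDomain.Carrier D) (y₀#0 : ApartnessDomain._#0 D y₀) where

  private
    module D = ApartnessDomain D
    module P = ApartnessDomain (Polynomials.polynomialDomain D)
  open Polynomials D
  open Fractions polynomialDomain
  open FibonacciLucas fractionField public
  open HeytingProperties heytingCommutativeRing using (#-congʳ; 1#0; x#0y#0→xy#0)

  x y : Carrier
  x = ι X
  y = ι (const y₀)

  private
    ι-cong : ∀ {u v} → u P.≈ v → ι u ≈ ι v
    ι-cong u≈v = cross (P.*-congʳ u≈v)

    ι-+ : ∀ u v → ι u + ι v ≈ ι (u P.+ v)
    ι-+ u v = cross (solve 3 (λ u v o → (u :* o :+ v :* o) :* o := (u :+ v) :* (o :* o)) P.refl u v P.1#)
      where open NaturalCoefficients P.commutativeSemiring using (solve; _:=_; _:+_; _:*_)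

    ι-* : ∀ u v → ι u * ι v ≈ ι (u P.* v)
    ι-* u v = cross (P.*-congˡ {u P.* v} (P.sym (P.*-identityˡ P.1#)))

    ι-#0 : ∀ {u} → u P.#0 → ι u # 0#
    ι-#0 {u} u#0 = cross# (P.#0-resp (P.sym eq) u#0)
      where
      open SetoidReasoning P.setoid
      eq : u P.* P.1# P.- P.0# P.* P.1# P.≈ u
      eq = begin
        u P.* P.1# P.- P.0# P.* P.1# ≈⟨ P.+-cong (P.*-identityʳ u) (P.-‿cong (P.zeroˡ P.1#)) ⟩
        u P.- P.0#                   ≈⟨ P.+-congˡ (RingProperties.-0#≈0# P.ring) ⟩
        u P.+ P.0#                   ≈⟨ P.+-identityʳ u ⟩
        u                            ∎

  -y#0 : (- y) # 0#
  -y#0 = ι-#0 (0 , D.-‿#0 y₀#0)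

  open Sequences x y -y#0 public

  private
    Scalar : Carrier → Set _
    Scalar f = ∃ λ a → f ≈ ι (const a) × a D.#0

    Below Degree : ℕ → Carrier → Set _
    Below  d f = ∃ λ u → f ≈ ι u × (∀ i → d ≤ i → coeff u i D.≈ D.0#)
    Degree d f = ∃ λ u → f ≈ ι u × coeff u d D.#0 × (∀ i → d < i → coeff u i D.≈ D.0#)

    below : ∀ {d e f} → d < e → Degree d f → Below e f
    below d<e (u , f≈u , _ , u≈0) = u , f≈u , λ i e≤i → u≈0 i (ℕ.<-≤-trans d<e e≤i)

    weaken : ∀ {d f} → Below d f → Below (1+ d) f
    weaken (u , f≈u , u≈0) = u , f≈u , λ i d<i → u≈0 i (ℕ.<⇒≤ d<i)

    Degree⇒#0 : ∀ {d f} → Degree d f → f # 0#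
    Degree⇒#0 {d} (u , f≈u , u#0 , _) = #-congʳ (sym f≈u) (ι-#0 (d , u#0))

    Degree-resp : ∀ {d f g} → f ≈ g → Degree d f → Degree d g
    Degree-resp f≈g (u , f≈u , rest) = u , trans (sym f≈g) f≈u , rest

    Degree-+ : ∀ {d f g} → Degree d f → Below d g → Degree d (f + g)
    Degree-+ {d} (u , f≈u , u#0 , u≈0) (v , g≈v , v≈0) =
      u P.+ v , trans (+-cong f≈u g≈v) (ι-+ u v) , lead , λ i d<i →
        D.trans (coeff-+ u v i) (D.trans (D.+-cong (u≈0 i d<i) (v≈0 i (ℕ.<⇒≤ d<i))) (D.+-identityˡ D.0#))
      where
      lead : coeff (u P.+ v) d D.#0
      lead = D.#0-resp (D.sym (D.trans (coeff-+ u v d) (D.trans (D.+-congˡ (v≈0 d ℕ.≤-refl)) (D.+-identityʳ _)))) u#0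

    Degree-neg : ∀ {d f} → Degree d f → Degree d (- f)
    Degree-neg {d} (u , f≈u , u#0 , u≈0) =
      P.- u , -‿cong f≈u , D.#0-resp (D.sym (coeff-neg u d)) (D.-‿#0 u#0) , λ i d<i →
        D.trans (coeff-neg u i) (D.trans (D.-‿cong (u≈0 i d<i)) (RingProperties.-0#≈0# D.ring))

    Degree-x* : ∀ {d f} → Degree d f → Degree (1+ d) (x * f)
    Degree-x* {d} (u , f≈u , u#0 , u≈0) =
      X P.* u , trans (*-congˡ f≈u) (ι-* X u) , D.#0-resp (D.sym (coeff-X-* u d)) u#0 , λ where
        (1+ i) (s≤s d<i) → D.trans (coeff-X-* u i) (u≈0 i d<i)

    Below-y* : ∀ {d f} → Below d f → Below d (y * f)
    Below-y* (u , f≈u , u≈0) =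
      const y₀ P.* u , trans (*-congˡ f≈u) (ι-* (const y₀) u) , λ i d≤i →
        D.trans (coeff-const-* y₀ u i) (D.trans (D.*-congˡ (u≈0 i d≤i)) (D.zeroʳ y₀))

    Degree-scalar : ∀ {d f g} → Scalar f → Degree d g → Degree d (f * g)
    Degree-scalar {d} (a , f≈a , a#0) (u , g≈u , u#0 , u≈0) =
      const a P.* u , trans (*-cong f≈a g≈u) (ι-* (const a) u) ,
      D.#0-resp (D.sym (coeff-const-* a u d)) (D.*-#0 a#0 u#0) , λ i d<i →
        D.trans (coeff-const-* a u i) (D.trans (D.*-congˡ (u≈0 i d<i)) (D.zeroʳ a))

    Scalar-* : ∀ {f g} → Scalar f → Scalar g → Scalar (f * g)
    Scalar-* (a , f≈a , a#0) (b , g≈b , b#0) =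
      a D.* b , trans (*-cong f≈a g≈b) (trans (ι-* (const a) (const b)) (ι-cong (coeffwise eq))) , D.*-#0 a#0 b#0
      where
      eq : ∀ i → coeff (const a P.* const b) i D.≈ coeff (const (a D.* b)) i
      eq zero   = coeff-const-* a (const b) 0
      eq (1+ i) = D.trans (coeff-const-* a (const b) (1+ i)) (D.zeroʳ a)

    [-y]^-scalar : ∀ n → Scalar ([-y]^ pos n)
    [-y]^-scalar zero   = D.1# , refl , D.1#0
    [-y]^-scalar (1+ n) = Scalar-* (D.- y₀ , refl , D.-‿#0 y₀#0) ([-y]^-scalar n)

    fib-degree : ∀ n → Degree n (fib (1+ n)) × Below n (fib n)
    fib-degree zero   = (P.1# , refl , D.1#0 , λ { (1+ _) _ → D.refl }) , (P.0# , refl , λ _ _ → D.refl)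
    fib-degree (1+ n) with fib-degree n
    ... | deg , bel = Degree-+ (Degree-x* deg) (Below-y* (weaken bel)) , below ℕ.≤-refl deg

    lucas-degree : ∀ n → Degree (1+ n) (lucas (1+ n)) × Below (1+ n) (lucas n)
    lucas-degree zero =
      (X , refl , D.1#0 , λ { (1+ zero) (s≤s ()) ; (1+ (1+ _)) _ → D.refl }) ,
      (P.1# P.+ P.1# , ι-+ P.1# P.1# , λ { (1+ _) _ → D.refl })
    lucas-degree (1+ n) with lucas-degree n
    ... | deg , bel = Degree-+ (Degree-x* deg) (Below-y* (weaken bel)) , below ℕ.≤-refl deg

    [-y]^*L-degree : ∀ a n .{{_ : NonZero n}} → Degree n ([-y]^ pos a * L (pos n))
    [-y]^*L-degree a (1+ n) = Degree-scalar ([-y]^-scalar a) (proj₁ (lucas-degree n))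

    difference#0 : ∀ {d e f g} → Degree d f → Degree e g → d ≢ e → (f - g) # 0#
    difference#0 {d} {e} {f} {g} deg-f deg-g d≢e with ℕ.<-cmp d e
    ... | tri< d<e _ _ = Degree⇒#0 (Degree-resp (+-comm (- g) f) (Degree-+ (Degree-neg deg-g) (below d<e deg-f)))
    ... | tri≈ _ d≡e _ = contradiction d≡e d≢e
    ... | tri> _ _ e<d = Degree⇒#0 (Degree-+ deg-f (below e<d (Degree-neg deg-g)))

  ∏#0 : ∀ n (f : Fin n → Carrier) → (∀ i → f i # 0#) → ∏ n f # 0#
  ∏#0 zero   f f#0 = 1#0
  ∏#0 (1+ n) f f#0 = x#0y#0→xy#0 (f#0 Fin.zero) (∏#0 n (λ i → f (Fin.suc i)) (λ i → f#0 (Fin.suc i)))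

  ∏-except#0 : ∀ {n} (j : Fin n) f → (∀ i → i ≢ j → f i # 0#) → ∏-except j f # 0#
  ∏-except#0 {n} j f f#0 = ∏#0 n _ factor#0
    where
    factor#0 : ∀ i → (if does (i Fin.≟ j) then 1# else f i) # 0#
    factor#0 i with i Fin.≟ j
    ... | yes _   = 1#0
    ... | no  i≢j = f#0 i i≢j

  F#0 : ∀ n .{{_ : NonZero n}} → F (pos n) # 0#
  F#0 (1+ n) = Degree⇒#0 (proj₁ (fib-degree n))

  private
    2s[p-j]≢0 : ∀ s p .{{_ : NonZero s}} (j : Fin p) → NonZero (2 ℕ.* s ℕ.* (p ∸ toℕ j))
    2s[p-j]≢0 s p j = ℕ.m*n≢0 (2 ℕ.* s) (p ∸ toℕ j) {{ℕ.m*n≢0 2 s}} {{ℕ.>-nonZero (ℕ.m<n⇒0<n∸m (toℕ<n j))}}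

    2j<2p-1 : ∀ p (j : Fin p) → 2 ℕ.* toℕ j < 2 ℕ.* p ∸ 1
    2j<2p-1 (1+ p) j = begin-strict
      2 ℕ.* toℕ j       ≤⟨ ℕ.*-monoʳ-≤ 2 (ℕ.m<1+n⇒m≤n (toℕ<n j)) ⟩
      2 ℕ.* p           <⟨ ℕ.n<1+n _ ⟩
      1+ (2 ℕ.* p)      ≡⟨ ≡.sym (ℕ.+-suc p (p ℕ.+ 0)) ⟩
      2 ℕ.* (1+ p) ∸ 1  ∎
      where open ℕ.≤-Reasoning

    s[2p-1-2j]≢0 : ∀ s p .{{_ : NonZero s}} (j : Fin p) → NonZero (s ℕ.* (2 ℕ.* p ∸ 1 ∸ 2 ℕ.* toℕ j))
    s[2p-1-2j]≢0 s p j = ℕ.m*n≢0 s _ {{it}} {{ℕ.>-nonZero (ℕ.m<n⇒0<n∸m (2j<2p-1 p j))}}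
      where
      it : NonZero s
      it = ℕ.≢-nonZero (ℕ.≢-nonZero⁻¹ s)

  𝒫#0 : ∀ s p .{{_ : NonZero s}} (j : Fin p) → 𝒫 s p j # 0#
  𝒫#0 s p j = ∏-except#0 j _ λ i i≢j →
    difference#0
      ([-y]^*L-degree (s ℕ.* toℕ j) _ {{2s[p-j]≢0 s p j}}) ([-y]^*L-degree (s ℕ.* toℕ i) _ {{2s[p-j]≢0 s p i}})
      (λ eq → i≢j (toℕ-injective (ℕ.∸-cancelˡ-≡ (ℕ.<⇒≤ (toℕ<n i)) (ℕ.<⇒≤ (toℕ<n j))
        (≡.sym (ℕ.*-cancelˡ-≡ _ _ (2 ℕ.* s) {{ℕ.m*n≢0 2 s}} eq)))))

  ℛ#0 : ∀ s p .{{_ : NonZero s}} (j : Fin p) → ℛ s p j # 0#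
  ℛ#0 s p j = ∏-except#0 j _ λ i i≢j →
    difference#0
      ([-y]^*L-degree (s ℕ.* toℕ j) _ {{s[2p-1-2j]≢0 s p j}}) ([-y]^*L-degree (s ℕ.* toℕ i) _ {{s[2p-1-2j]≢0 s p i}})
      (λ eq → i≢j (toℕ-injective (ℕ.*-cancelˡ-≡ _ _ 2 (ℕ.∸-cancelˡ-≡ (ℕ.<⇒≤ (2j<2p-1 p i)) (ℕ.<⇒≤ (2j<2p-1 p j))
        (≡.sym (ℕ.*-cancelˡ-≡ _ _ s eq))))))

  𝒫*F#0 : ∀ s p .{{_ : NonZero s}} (j : Fin p) → (𝒫 s p j * F (pos (2 ℕ.* s ℕ.* (p ∸ toℕ j)))) # 0#
  𝒫*F#0 s p j = x#0y#0→xy#0 (𝒫#0 s p j) (F#0 _ {{2s[p-j]≢0 s p j}})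

  ℛ*F#0 : ∀ s p .{{_ : NonZero s}} (j : Fin p) → (ℛ s p j * F (pos (s ℕ.* (2 ℕ.* p ∸ 1 ∸ 2 ℕ.* toℕ j)))) # 0#
  ℛ*F#0 s p j = x#0y#0→xy#0 (ℛ#0 s p j) (F#0 _ {{s[2p-1-2j]≢0 s p j}})

  fibopolynomial : ∀ s .{{_ : NonZero s}} → ℕ → ℕ → Carrier
  fibopolynomial s n k =
    (∏[ i < k ] F (pos s ℤ.* (pos n ℤ.- pos (toℕ i))))
    / (∏[ i < k ] F (pos (s ℕ.* 1+ (toℕ i))))
    [ ∏#0 k _ (λ i → F#0 (s ℕ.* 1+ (toℕ i)) {{ℕ.m*n≢0 s (1+ (toℕ i))}}) ]

-- K(x,y) as the fraction field of K[y][x].  The library has no ℂ; the ground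
-- field is arbitrary, and nothing below depends on its characteristic.

module RationalFunctions {c ℓ₁ ℓ₂ : Level} (K : HeytingField c ℓ₁ ℓ₂) where
  private
    K[y] : ApartnessDomain c ℓ₁ ℓ₂
    K[y] = Polynomials.polynomialDomain (groundDomain K)
    Y : ApartnessDomain.Carrier K[y]
    Y = Polynomials.X (groundDomain K)
    Y#0 : ApartnessDomain._#0 K[y] Y
    Y#0 = 1 , ApartnessDomain.1#0 (groundDomain K)
  open FractionFieldOfPolynomials K[y] Y Y#0 public

{-# OPTIONS --safe #-}

-- With F_{sm}/F_s a Lucas sequence of parameters L_s and q = (-y)^s, write N = n + 1 - k.  Up to the factors ℛ and 𝒫,
-- the right-hand sides are divided differences, at the nodes e_j = q^j L_{s(r-2j)} with r = 2p - 1 or 2p, of the solution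
-- u_N(e) of u_{N+2} + q^r u_N = e u_{N+1} + f_N with u_0 = 0 and u_1 = 1.  Here f = 0 in the second identity; in the
-- first one the convolution with a geometric sequence amounts to f_N = q^{p(N+1)}.  The Leibniz rule expresses the divided
-- difference at p nodes through that at the p - 1 nodes without e_0, which are the nodes for r - 2 scaled by q.  The
-- fibopolynomials satisfy the same recurrence by Vajda's identity, so both sides agree by induction on p.
-- For N < 0 both sides vanish, because u_{-N} is u_N up to a factor that is the same for all nodes.

module Submission where

open import Level using (Level)
open import Defs
open import Algebra.Apartness.Bundles using (HeytingField; HeytingCommutativeRing)
open import Algebra.Bundles using (CommutativeRing)
import Algebra.Apartness.Properties.HeytingCommutativeRing as HeytingProperties
import Algebra.Properties.CommutativeMonoid.Sum as MonoidSum
import Algebra.Properties.CommutativeSemiring.Exp as CommutativeExponentiation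
import Algebra.Properties.Ring as RingProperties
import Algebra.Properties.Semiring.Exp as Exponentiation
import Algebra.Properties.Semiring.Sum as SemiringSum
import Algebra.Solver.Ring.NaturalCoefficients.Default as NaturalCoefficients
open import Data.Fin.Base as Fin using (Fin; toℕ; punchIn)
import Data.Fin.Properties as Fin
open import Data.Integer.Base as ℤ using (ℤ; -[1+_]) renaming (+_ to pos)
import Data.Integer.Properties as ℤ
open import Data.Nat.Base as ℕ using (ℕ; zero; suc; _∸_; _≤_; _<_; z≤n; s≤s; NonZero)
import Data.Nat.Properties as ℕ
open import Data.Nat.Solver using (module +-*-Solver)
open import Data.Product.Base using (_×_; _,_; proj₁; proj₂)
open import Function.Base using (_∘_)
open import Relation.Nullary using (yes; no)
open import Relation.Binary.PropositionalEquality as ≡ using (_≡_)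
import Relation.Binary.Reasoning.Setoid as SetoidReasoning

-- Let α and β be the roots of t² = xt + y, and put d = s(r - 2j). At the node e_j the recurrence
-- has the characteristic roots q^j α^d and q^j β^d. Their product q^(2j) (-y)^d equals q^r for
-- every j, so one constant Q serves all nodes, and u_N(e_j) = q^(j(N-1)) F_(dN) / F_d is a summand
-- of the theorem without its factor ℛ or 𝒫. Those factors are products of differences of nodes,
-- which is why divided differences appear. The proof avoids division: the only inverses it uses are
-- those of -y and of the denominators in the statement. Hence weights are characterised by the
-- equation `Weights`, Fibonacci products are compared with denominators cleared, and a sequence
-- scaled by powers of g is compared from index 1 on, where no g^(-1) occurs.

module Interpolation {c ℓ : Level} (R : CommutativeRing c ℓ) where
  open CommutativeRing R
  open RingProperties ring using (+-cancelʳ)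
  open SemiringSum semiring using (sum; sum-cong-≋; ∑-distrib-+; *-distribˡ-sum; *-distribʳ-sum)
  open MonoidSum *-commutativeMonoid using () renaming (sum to product)
  open Exponentiation semiring using (_^_)
  open NaturalCoefficients commutativeSemiring using (solve; _:=_; _:+_; _:*_)
  open SetoidReasoning setoid

  -- Weights of divided differences over a commutative ring.

  a+[b-a]≈b : ∀ a b → a + (b - a) ≈ b
  a+[b-a]≈b a b = begin
    a + (b - a)   ≈⟨ +-congˡ (+-comm b (- a)) ⟩
    a + (- a + b) ≈⟨ +-assoc a (- a) b ⟨
    (a - a) + b   ≈⟨ +-congʳ (-‿inverseʳ a) ⟩
    0# + b        ≈⟨ +-identityˡ b ⟩
    b             ∎

  [a-b]+[c-a]≈c-b : ∀ a b c → (a - b) + (c - a) ≈ c - b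
  [a-b]+[c-a]≈c-b a b c = begin
    (a - b) + (c - a)   ≈⟨ +-comm _ _ ⟩
    (c - a) + (a - b)   ≈⟨ +-assoc (c - a) a (- b) ⟨
    ((c - a) + a) - b   ≈⟨ +-congʳ (trans (+-comm _ _) (a+[b-a]≈b a c)) ⟩
    c - b               ∎

  -- The divided difference of f at the nodes e is ∑ⱼ wⱼ f(eⱼ).
  Weights : ∀ n (e w : Fin (suc n) → Carrier) → Set ℓ
  Weights n e w = ∀ j → w j * product (λ i → e j - e (punchIn j i)) ≈ 1#

  -- Deleting node k removes the factor `e j - e k` from the product at node j, so the weight
  -- absorbs it.
  reweight : ∀ {n} (k : Fin (suc n)) (e w : Fin (suc n) → Carrier) → Fin n → Carrier
  reweight k e w j = w (punchIn k j) * (e (punchIn k j) - e k)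

  Weights-remove₀ : ∀ {n e w} → Weights (suc n) e w →
                    Weights n (e ∘ punchIn Fin.zero) (reweight Fin.zero e w)
  Weights-remove₀ W j = trans (*-assoc _ _ _) (W (Fin.suc j))

  Weights-remove₁ : ∀ {n e w} → Weights (suc n) e w →
                    Weights n (e ∘ punchIn (Fin.suc Fin.zero)) (reweight (Fin.suc Fin.zero) e w)
  Weights-remove₁         W Fin.zero    = trans (*-assoc _ _ _) (W Fin.zero)
  -- At the nodes after the deleted one, the deleted factor stands second in the product, behind the
  -- one for node 0.
  Weights-remove₁ {suc n} W (Fin.suc j) =
    trans (exchange _ _ _ _) (W (Fin.suc (Fin.suc j)))
    where
    exchange : ∀ a b c d → (a * b) * (c * d) ≈ a * (c * (b * d))
    exchange = solve 4 (λ a b c d → (a :* b) :* (c :* d) := a :* (c :* (b :* d))) refl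

  *[-]-zero : ∀ a b → a * (b - b) ≈ 0#
  *[-]-zero a b = trans (*-congˡ (-‿inverseʳ b)) (zeroʳ a)

  -- The divided difference of a constant. Multiplied by `d`, the sum is the difference between the
  -- sums of weights left after deleting node 1 and node 0. These agree: both are 1 for a single
  -- remaining node, and 0 by induction otherwise. Finally `d` cancels, being a factor of the
  -- product that `W` inverts at node 0.
  ∑-weights : ∀ {n e w} → Weights (suc n) e w → sum w ≈ 0#
  ∑-weights {n} {e} {w} W = begin
    sum w                       ≈⟨ *-identityˡ _ ⟨
    1# * sum w                  ≈⟨ *-congʳ (W Fin.zero) ⟨
    w₀ * (d * _) * sum w        ≈⟨ rearrange w₀ d _ (sum w) ⟩
    (w₀ * _) * (d * sum w)      ≈⟨ *-congˡ d*∑w≈0 ⟩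
    (w₀ * _) * 0#               ≈⟨ zeroʳ _ ⟩
    0#                          ∎
    where
    w₀ d : Carrier
    w₀ = w Fin.zero
    d  = e Fin.zero - e (Fin.suc Fin.zero)

    rearrange : ∀ a b c d → a * (b * c) * d ≈ (a * c) * (b * d)
    rearrange = solve 4 (λ a b c d → a :* (b :* c) :* d := (a :* c) :* (b :* d)) refl

    removals-agree : ∀ n {e w e′ w′} → Weights n e w → Weights n e′ w′ → sum w ≈ sum w′
    removals-agree zero    W W′ = +-congʳ (trans (sym (*-identityʳ _))
      (trans (W Fin.zero) (trans (sym (W′ Fin.zero)) (*-identityʳ _))))
    removals-agree (suc n) W W′ = trans (∑-weights W) (sym (∑-weights W′))

    remove : ∀ k → Carrier
    remove k = sum (λ j → w j * (e j - e k))

    d*∑w+remove₀≈remove₁ : d * sum w + remove Fin.zero ≈ remove (Fin.suc Fin.zero)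
    d*∑w+remove₀≈remove₁ = begin
      d * sum w + remove Fin.zero
        ≈⟨ +-congʳ (*-distribˡ-sum d w) ⟩
      sum (λ j → d * w j) + remove Fin.zero
        ≈⟨ ∑-distrib-+ (λ j → d * w j) (λ j → w j * (e j - e Fin.zero)) ⟨
      sum (λ j → d * w j + w j * (e j - e Fin.zero))
        ≈⟨ sum-cong-≋ (λ j → trans (trans (+-congʳ (*-comm d (w j))) (sym (distribˡ _ _ _)))
             (*-congˡ ([a-b]+[c-a]≈c-b (e Fin.zero) (e (Fin.suc Fin.zero)) (e j)))) ⟩
      remove (Fin.suc Fin.zero) ∎

    remove₀ : remove Fin.zero ≈ sum (reweight Fin.zero e w)
    remove₀ = trans (+-congʳ (*[-]-zero _ _)) (+-identityˡ _)

    remove₁ : remove (Fin.suc Fin.zero) ≈ sum (reweight (Fin.suc Fin.zero) e w)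
    remove₁ = +-congˡ (trans (+-congʳ (*[-]-zero _ _)) (+-identityˡ _))

    d*∑w≈0 : d * sum w ≈ 0#
    d*∑w≈0 = +-cancelʳ (remove Fin.zero) _ _ (begin
      d * sum w + remove Fin.zero                ≈⟨ d*∑w+remove₀≈remove₁ ⟩
      remove (Fin.suc Fin.zero)                  ≈⟨ remove₁ ⟩
      sum (reweight (Fin.suc Fin.zero) e w)
        ≈⟨ removals-agree n (Weights-remove₁ {e = e} W) (Weights-remove₀ {e = e} W) ⟩
      sum (reweight Fin.zero e w)                ≈⟨ remove₀ ⟨
      remove Fin.zero                            ≈⟨ +-identityˡ _ ⟨
      0# + remove Fin.zero                       ∎)

  -- Solutions of a second-order recurrence and their divided differences.

  solution : (e Q : Carrier) → (ℕ → Carrier) → ℕ → Carrier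
  solution e Q f zero          = 0#
  solution e Q f (suc zero)    = 1#
  -- `f N` first acts at index N + 2. For f = 0 this is the Lucas sequence U_N(e, Q).
  solution e Q f (suc (suc N)) = (e * solution e Q f (suc N) + f N) - Q * solution e Q f N

  solution-recurrence : ∀ e Q f N → solution e Q f (2 ℕ.+ N) + Q * solution e Q f N
                                      ≈ e * solution e Q f (1 ℕ.+ N) + f N
  solution-recurrence e Q f N = trans (+-comm _ _) (a+[b-a]≈b _ _)

  dividedSolution : ∀ {n} (e w : Fin n → Carrier) → Carrier → (ℕ → Carrier) → ℕ → Carrier
  dividedSolution e w Q f N = sum (λ j → w j * solution (e j) Q f N)

  dividedSolution₀ : ∀ {n} (e w : Fin n → Carrier) Q f → dividedSolution e w Q f 0 ≈ 0#
  dividedSolution₀ e w Q f = begin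
    sum (λ j → w j * 0#) ≈⟨ *-distribʳ-sum 0# w ⟨
    sum w * 0#           ≈⟨ zeroʳ _ ⟩
    0#                   ∎

  -- The initial value 1 is constant in the node, so it disappears as soon as there are two nodes.
  dividedSolution₁ : ∀ {n e w} Q f → Weights (suc n) e w → dividedSolution e w Q f 1 ≈ 0#
  dividedSolution₁ {e = e} {w} Q f W = begin
    sum (λ j → w j * 1#) ≈⟨ *-distribʳ-sum 1# w ⟨
    sum w * 1#           ≈⟨ *-identityʳ _ ⟩
    sum w                ≈⟨ ∑-weights {e = e} W ⟩
    0#                   ∎

  -- The Leibniz rule for divided differences; the inhomogeneity f is constant in the node.
  dividedSolution-recurrence : ∀ {n e w} Q f → Weights (suc n) e w → ∀ N →
    dividedSolution e w Q f (2 ℕ.+ N) + Q * dividedSolution e w Q f N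
      ≈ e Fin.zero * dividedSolution e w Q f (1 ℕ.+ N)
        + dividedSolution (e ∘ Fin.suc) (reweight Fin.zero e w) Q f (1 ℕ.+ N)
  dividedSolution-recurrence {n} {e} {w} Q f W N = begin
    sum (λ j → w j * u j (2 ℕ.+ N)) + Q * sum (λ j → w j * u j N)
      ≈⟨ +-congˡ (*-distribˡ-sum Q (λ j → w j * u j N)) ⟩
    sum (λ j → w j * u j (2 ℕ.+ N)) + sum (λ j → Q * (w j * u j N))
      ≈⟨ ∑-distrib-+ (λ j → w j * u j (2 ℕ.+ N)) (λ j → Q * (w j * u j N)) ⟨
    sum (λ j → w j * u j (2 ℕ.+ N) + Q * (w j * u j N))
      ≈⟨ sum-cong-≋ pointwise ⟩
    sum (λ j → (e₀ * (w j * u j (1 ℕ.+ N)) + w j * (e j - e₀) * u j (1 ℕ.+ N)) + w j * f N)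
      ≈⟨ trans (∑-distrib-+ (λ j → a j + b j) (λ j → w j * f N)) (+-congʳ (∑-distrib-+ a b)) ⟩
    (sum (λ j → e₀ * (w j * u j (1 ℕ.+ N))) + sum (λ j → w j * (e j - e₀) * u j (1 ℕ.+ N)))
      + sum (λ j → w j * f N)
      ≈⟨ +-cong (+-cong (sym (*-distribˡ-sum e₀ (λ j → w j * u j (1 ℕ.+ N)))) drop₀) ∑w*f≈0 ⟩
    (e₀ * C (1 ℕ.+ N) + dividedSolution (e ∘ Fin.suc) (reweight Fin.zero e w) Q f (1 ℕ.+ N)) + 0#
      ≈⟨ +-identityʳ _ ⟩
    e₀ * C (1 ℕ.+ N) + dividedSolution (e ∘ Fin.suc) (reweight Fin.zero e w) Q f (1 ℕ.+ N) ∎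
    where
    u : Fin (suc (suc n)) → ℕ → Carrier
    u j = solution (e j) Q f
    C : ℕ → Carrier
    C = dividedSolution e w Q f
    e₀ : Carrier
    e₀ = e Fin.zero
    a b : Fin (suc (suc n)) → Carrier
    a j = e₀ * (w j * u j (1 ℕ.+ N))
    b j = w j * (e j - e₀) * u j (1 ℕ.+ N)

    collect : ∀ w u Q v → w * u + Q * (w * v) ≈ w * (u + Q * v)
    collect = solve 4 (λ w u Q v → w :* u :+ Q :* (w :* v) := w :* (u :+ Q :* v)) refl
    expand : ∀ w e d u f → w * ((e + d) * u + f) ≈ (e * (w * u) + w * d * u) + w * f
    expand = solve 5 (λ w e d u f →
      w :* ((e :+ d) :* u :+ f) := (e :* (w :* u) :+ w :* d :* u) :+ w :* f) refl

    pointwise : ∀ j → w j * u j (2 ℕ.+ N) + Q * (w j * u j N)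
      ≈ (e₀ * (w j * u j (1 ℕ.+ N)) + w j * (e j - e₀) * u j (1 ℕ.+ N)) + w j * f N
    pointwise j = begin
      w j * u j (2 ℕ.+ N) + Q * (w j * u j N)
        ≈⟨ collect _ _ _ _ ⟩
      w j * (u j (2 ℕ.+ N) + Q * u j N)
        ≈⟨ *-congˡ (solution-recurrence (e j) Q f N) ⟩
      w j * (e j * u j (1 ℕ.+ N) + f N)
        -- The part e₀ gives the coefficient of the recurrence; the part `e j - e₀` turns `w` into
        -- the weights without node 0.
        ≈⟨ *-congˡ (+-congʳ (*-congʳ (a+[b-a]≈b e₀ (e j)))) ⟨
      w j * ((e₀ + (e j - e₀)) * u j (1 ℕ.+ N) + f N)
        ≈⟨ expand _ _ _ _ _ ⟩
      (e₀ * (w j * u j (1 ℕ.+ N)) + w j * (e j - e₀) * u j (1 ℕ.+ N)) + w j * f N ∎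

    drop₀ : sum (λ j → w j * (e j - e₀) * u j (1 ℕ.+ N))
              ≈ dividedSolution (e ∘ Fin.suc) (reweight Fin.zero e w) Q f (1 ℕ.+ N)
    drop₀ = trans (+-congʳ (trans (*-congʳ (*[-]-zero _ _)) (zeroˡ _))) (+-identityˡ _)

    ∑w*f≈0 : sum (λ j → w j * f N) ≈ 0#
    ∑w*f≈0 = trans (sym (*-distribʳ-sum (f N) w)) (trans (*-congʳ (∑-weights {e = e} W)) (zeroˡ _))

  -- The sequence g^(N-1) Y_N satisfies the recurrence of X, and two consecutive values determine a
  -- solution.
  scaled-unique : ∀ {X Y r : ℕ → Carrier} {g l Q} →
    X 0 ≈ 0# → Y 0 ≈ 0# → X 1 ≈ Y 1 →
    (∀ N → X (2 ℕ.+ N) + (g * g * Q) * X N ≈ (g * l) * X (1 ℕ.+ N) + g ^ suc N * r N) →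
    (∀ N → Y (2 ℕ.+ N) + Q * Y N ≈ l * Y (1 ℕ.+ N) + r N) →
    ∀ M → X (1 ℕ.+ M) ≈ g ^ M * Y (1 ℕ.+ M)
  scaled-unique {X} {Y} {r} {g} {l} {Q} X₀≈0 Y₀≈0 X₁≈Y₁ X-rec Y-rec = λ M → proj₁ (both M)
    where
    regroup : ∀ g l p q r → (g * l) * (p * q) + (g * p) * r ≈ (g * p) * (l * q + r)
    regroup = solve 5 (λ g l p q r → (g :* l) :* (p :* q) :+ (g :* p) :* r := (g :* p) :* (l :* q :+ r)) refl

    next : ∀ N → (g * g * Q) * X N ≈ g ^ suc N * (Q * Y N) →
           X (1 ℕ.+ N) ≈ g ^ N * Y (1 ℕ.+ N) → X (2 ℕ.+ N) ≈ g ^ suc N * Y (2 ℕ.+ N)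
    next N shifted IH = +-cancelʳ ((g * g * Q) * X N) _ _ (begin
      X (2 ℕ.+ N) + (g * g * Q) * X N
        ≈⟨ X-rec N ⟩
      (g * l) * X (1 ℕ.+ N) + g ^ suc N * r N
        ≈⟨ +-congʳ (*-congˡ IH) ⟩
      (g * l) * (g ^ N * Y (1 ℕ.+ N)) + g ^ suc N * r N
        ≈⟨ regroup g l _ _ (r N) ⟩
      g ^ suc N * (l * Y (1 ℕ.+ N) + r N)
        ≈⟨ *-congˡ (Y-rec N) ⟨
      g ^ suc N * (Y (2 ℕ.+ N) + Q * Y N)
        ≈⟨ distribˡ _ _ _ ⟩
      g ^ suc N * Y (2 ℕ.+ N) + g ^ suc N * (Q * Y N)
        ≈⟨ +-congˡ shifted ⟨
      g ^ suc N * Y (2 ℕ.+ N) + (g * g * Q) * X N ∎)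

    both : ∀ M → (X (1 ℕ.+ M) ≈ g ^ M * Y (1 ℕ.+ M)) × (X (2 ℕ.+ M) ≈ g ^ suc M * Y (2 ℕ.+ M))
    both zero = X₁≈1*Y₁ , next 0 0≈0 X₁≈1*Y₁
      where
      X₁≈1*Y₁ : X 1 ≈ 1# * Y 1
      X₁≈1*Y₁ = trans X₁≈Y₁ (sym (*-identityˡ _))
      -- At index 0 the factor would be g^(-1); both initial values are zero instead.
      0≈0 : (g * g * Q) * X 0 ≈ g ^ 1 * (Q * Y 0)
      0≈0 = trans (trans (*-congˡ X₀≈0) (zeroʳ _))
              (sym (trans (*-congˡ (trans (*-congˡ Y₀≈0) (zeroʳ _))) (zeroʳ _)))
    both (suc M) with both M
    ... | X₁ , X₂ = X₂ , next (suc M) (trans (*-congˡ X₁) (shift g Q _ _)) X₂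
      where
      shift : ∀ g Q p v → (g * g * Q) * (p * v) ≈ (g * (g * p)) * (Q * v)
      shift = solve 4 (λ g Q p v → (g :* g :* Q) :* (p :* v) := (g :* (g :* p)) :* (Q :* v)) refl

  -- Convolving the homogeneous solution with a geometric sequence again solves the recurrence.
  solution-geometric : ∀ e Q h N → solution e Q (λ N → h ^ suc N) (suc N)
    ≈ h * solution e Q (λ N → h ^ suc N) N + solution e Q (λ _ → 0#) (suc N)
  solution-geometric e Q h = λ N → proj₁ (both N)
    where
    u v : ℕ → Carrier
    u = solution e Q (λ N → h ^ suc N)
    v = solution e Q (λ _ → 0#)

    Step : ℕ → Set ℓ
    Step N = u (suc N) ≈ h * u N + v (suc N)

    next : ∀ N → (e * u (1 ℕ.+ N) + h ^ suc N) + Q * v N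
                   ≈ (h * u (1 ℕ.+ N) + (e * v (1 ℕ.+ N) + 0#)) + Q * u N → Step (suc N)
    next N eq = +-cancelʳ (Q * u N + Q * v N) _ _ (begin
      u (2 ℕ.+ N) + (Q * u N + Q * v N)
        ≈⟨ +-assoc _ _ _ ⟨
      (u (2 ℕ.+ N) + Q * u N) + Q * v N
        ≈⟨ +-congʳ (solution-recurrence e Q _ N) ⟩
      (e * u (1 ℕ.+ N) + h ^ suc N) + Q * v N
        ≈⟨ eq ⟩
      (h * u (1 ℕ.+ N) + (e * v (1 ℕ.+ N) + 0#)) + Q * u N
        ≈⟨ +-congʳ (+-congˡ (solution-recurrence e Q _ N)) ⟨
      (h * u (1 ℕ.+ N) + (v (2 ℕ.+ N) + Q * v N)) + Q * u N
        ≈⟨ regroup _ _ _ _ ⟩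
      (h * u (1 ℕ.+ N) + v (2 ℕ.+ N)) + (Q * u N + Q * v N) ∎)
      where
      regroup : ∀ a b c d → (a + (b + c)) + d ≈ (a + b) + (d + c)
      regroup = solve 4 (λ a b c d → (a :+ (b :+ c)) :+ d := (a :+ b) :+ (d :+ c)) refl

    both : ∀ N → Step N × Step (suc N)
    both zero = sym (trans (+-congʳ (zeroʳ h)) (+-identityˡ 1#)) , next 0 (begin
      (e * 1# + h * 1#) + Q * 0#           ≈⟨ +-congʳ (trans (+-comm _ _) (+-congˡ (sym (+-identityʳ _)))) ⟩
      (h * 1# + (e * 1# + 0#)) + Q * 0#    ∎)
    both (suc N) with both N
    ... | step , step′ = step′ , next (suc N) (begin
      (e * u (2 ℕ.+ N) + h ^ (2 ℕ.+ N)) + Q * v (1 ℕ.+ N)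
        ≈⟨ +-congʳ (+-congʳ (*-congˡ step′)) ⟩
      (e * (h * u (1 ℕ.+ N) + v (2 ℕ.+ N)) + h ^ (2 ℕ.+ N)) + Q * v (1 ℕ.+ N)
        ≈⟨ regroup₁ e h _ _ _ _ ⟩
      (h * (e * u (1 ℕ.+ N) + h ^ suc N) + e * v (2 ℕ.+ N)) + Q * v (1 ℕ.+ N)
        ≈⟨ +-congʳ (+-congʳ (*-congˡ (solution-recurrence e Q _ N))) ⟨
      (h * (u (2 ℕ.+ N) + Q * u N) + e * v (2 ℕ.+ N)) + Q * v (1 ℕ.+ N)
        ≈⟨ regroup₂ h _ Q _ _ _ ⟩
      (h * u (2 ℕ.+ N) + e * v (2 ℕ.+ N)) + Q * (h * u N + v (1 ℕ.+ N))
        ≈⟨ +-cong (+-congˡ (+-identityʳ _)) (*-congˡ step) ⟨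
      (h * u (2 ℕ.+ N) + (e * v (2 ℕ.+ N) + 0#)) + Q * u (1 ℕ.+ N) ∎)
      where
      regroup₁ : ∀ e h u v k w → (e * (h * u + v) + h * k) + w ≈ (h * (e * u + k) + e * v) + w
      regroup₁ = solve 6 (λ e h u v k w → (e :* (h :* u :+ v) :+ h :* k) :+ w := (h :* (e :* u :+ k) :+ e :* v) :+ w) refl
      regroup₂ : ∀ h u Q u′ v v′ → (h * (u + Q * u′) + v) + Q * v′ ≈ (h * u + v) + Q * (h * u′ + v′)
      regroup₂ = solve 6 (λ h u Q u′ v v′ → (h :* (u :+ Q :* u′) :+ v) :+ Q :* v′ := (h :* u :+ v) :+ Q :* (h :* u′ :+ v′)) refl

  dividedSolution-geometric : ∀ {n} (e w : Fin n → Carrier) Q h N →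
    dividedSolution e w Q (λ N → h ^ suc N) (suc N)
      ≈ h * dividedSolution e w Q (λ N → h ^ suc N) N + dividedSolution e w Q (λ _ → 0#) (suc N)
  dividedSolution-geometric e w Q h N = begin
    sum (λ j → w j * u j (suc N))
      ≈⟨ sum-cong-≋ (λ j → trans (*-congˡ (solution-geometric (e j) Q h N)) (regroup _ _ _ _)) ⟩
    sum (λ j → h * (w j * u j N) + w j * v j (suc N))
      ≈⟨ ∑-distrib-+ (λ j → h * (w j * u j N)) (λ j → w j * v j (suc N)) ⟩
    sum (λ j → h * (w j * u j N)) + sum (λ j → w j * v j (suc N))
      ≈⟨ +-congʳ (*-distribˡ-sum h (λ j → w j * u j N)) ⟨
    h * sum (λ j → w j * u j N) + sum (λ j → w j * v j (suc N)) ∎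
    where
    u v : Fin _ → ℕ → Carrier
    u j = solution (e j) Q (λ N → h ^ suc N)
    v j = solution (e j) Q (λ _ → 0#)
    regroup : ∀ w h u v → w * (h * u + v) ≈ h * (w * u) + w * v
    regroup = solve 4 (λ w h u v → w :* (h :* u :+ v) := h :* (w :* u) :+ w :* v) refl

-- Both identities are treated through the index s(2(p - j) + c), with c = 2 here and c = 1 in
-- `odd-index`. From here on `p` is mostly the number of nodes minus one, hence one less than in the
-- theorem.
even-index : ∀ s p (j : Fin (suc p)) → 2 ℕ.* s ℕ.* (suc p ∸ toℕ j) ≡ s ℕ.* ((p ∸ toℕ j) ℕ.* 2 ℕ.+ 2)
even-index s p j = ≡.trans (≡.cong (2 ℕ.* s ℕ.*_) (ℕ.+-∸-assoc 1 (Fin.toℕ≤pred[n] j)))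
  (solve 2 (λ s d → con 2 :* s :* (con 1 :+ d) := s :* (d :* con 2 :+ con 2)) ≡.refl s (p ∸ toℕ j))
  where open +-*-Solver

odd-index : ∀ s p (j : Fin (suc p)) →
  s ℕ.* (2 ℕ.* suc p ∸ 1 ∸ 2 ℕ.* toℕ j) ≡ s ℕ.* ((p ∸ toℕ j) ℕ.* 2 ℕ.+ 1)
odd-index s p j = ≡.cong (s ℕ.*_) (≡.trans
  (≡.cong (λ m → 2 ℕ.* suc m ∸ 1 ∸ 2 ℕ.* toℕ j) (≡.sym (ℕ.m∸n+n≡m (Fin.toℕ≤pred[n] j))))
  (≡.trans (≡.cong (_∸ 2 ℕ.* toℕ j)
    (solve 2 (λ d j → d :+ j :+ (con 1 :+ (d :+ j :+ con 0)) := d :* con 2 :+ con 1 :+ con 2 :* j) ≡.refl (p ∸ toℕ j) (toℕ j)))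
    (ℕ.m+n∸n≡m ((p ∸ toℕ j) ℕ.* 2 ℕ.+ 1) (2 ℕ.* toℕ j))))
  where open +-*-Solver

module FibonacciInterpolation {c ℓ₁ ℓ₂ : Level} (𝔽 : HeytingField c ℓ₁ ℓ₂)
  (x y : HeytingField.Carrier 𝔽)
  (-y#0 : HeytingField._#_ 𝔽 (HeytingField.-_ 𝔽 y) (HeytingField.0# 𝔽)) where

  open FibonacciLucas 𝔽
  open Sequences x y -y#0
  open RingProperties ring using (+-cancelʳ; -‿distribˡ-*; -‿distribʳ-*; -0#≈0#)
  open HeytingProperties heytingCommutativeRing using (x-0≈x)
  open SemiringSum semiring using (sum-cong-≋; *-distribˡ-sum)
  open MonoidSum *-commutativeMonoid using () renaming (sum-cong-≋ to product-cong)
  open Exponentiation semiring using (^-homo-*; ^-assocʳ; ^-congˡ)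
  open CommutativeExponentiation commutativeSemiring using (^-distrib-*)
  open NaturalCoefficients commutativeSemiring using (solve; _:=_; _:+_; _:*_)
  open SetoidReasoning setoid
  open Interpolation (HeytingCommutativeRing.commutativeRing heytingCommutativeRing)

  private
    z : Carrier
    z = - y

  -- Identities for Fibonacci and Lucas polynomials and for products of them.

  fib-≡ : ∀ {m n} → m ≡ n → fib m ≈ fib n
  fib-≡ eq = reflexive (≡.cong fib eq)

  z^-≡ : ∀ {m n} → m ≡ n → z ^ m ≈ z ^ n
  z^-≡ eq = reflexive (≡.cong (z ^_) eq)

  fib-+ : ∀ m n → fib (suc (m ℕ.+ n)) ≈ fib (suc m) * fib (suc n) + y * (fib m * fib n)
  fib-+ zero n = begin
    fib (suc n)                             ≈⟨ *-identityˡ _ ⟨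
    1# * fib (suc n)                        ≈⟨ +-identityʳ _ ⟨
    1# * fib (suc n) + 0#                   ≈⟨ +-congˡ (trans (*-congˡ (zeroˡ _)) (zeroʳ y)) ⟨
    1# * fib (suc n) + y * (0# * fib n)     ∎
  fib-+ (suc m) n = begin
    fib (2 ℕ.+ (m ℕ.+ n))
      ≈⟨ fib-≡ (≡.cong suc (≡.sym (ℕ.+-suc m n))) ⟩
    fib (suc (m ℕ.+ suc n))
      ≈⟨ fib-+ m (suc n) ⟩
    fib (suc m) * (x * fib (suc n) + y * fib n) + y * (fib m * fib (suc n))
      ≈⟨ regroup x y (fib (suc m)) (fib m) (fib (suc n)) (fib n) ⟩
    (x * fib (suc m) + y * fib m) * fib (suc n) + y * (fib (suc m) * fib n) ∎
    where
    regroup : ∀ x y a b c d → a * (x * c + y * d) + y * (b * c) ≈ (x * a + y * b) * c + y * (a * d)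
    regroup = solve 6 (λ x y a b c d →
      a :* (x :* c :+ y :* d) :+ y :* (b :* c) := (x :* a :+ y :* b) :* c :+ y :* (a :* d)) refl

  -- Split 2n+i+j as (n+i)+(n+j) and as n+(n+i+j). The two expansions by `fib-+` show that F_{n+i}
  -- F_{n+j} - F_n F_{n+i+j} is multiplied by -y when n grows by 1.
  vajda : ∀ n i j → fib (n ℕ.+ i) * fib (n ℕ.+ j) ≈ fib n * fib (n ℕ.+ (i ℕ.+ j)) + z ^ n * (fib i * fib j)
  vajda zero i j = begin
    fib i * fib j                                    ≈⟨ *-identityˡ _ ⟨
    1# * (fib i * fib j)                             ≈⟨ +-identityˡ _ ⟨
    0# + 1# * (fib i * fib j)                        ≈⟨ +-congʳ (zeroˡ _) ⟨
    0# * fib (i ℕ.+ j) + 1# * (fib i * fib j)        ∎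
  vajda (suc n) i j = +-cancelʳ (y * (a * d + t)) _ _ (begin
    a′ * b′ + y * (a * d + t)
      ≈⟨ +-congˡ (*-congˡ (vajda n i j)) ⟨
    a′ * b′ + y * (fib (n ℕ.+ i) * fib (n ℕ.+ j))
      ≈⟨ fib-+ (n ℕ.+ i) (n ℕ.+ j) ⟨
    fib (suc ((n ℕ.+ i) ℕ.+ (n ℕ.+ j)))
      ≈⟨ fib-≡ (≡.cong suc (+-*-Solver.solve 3 (λ n i j → (n ∶+ i) ∶+ (n ∶+ j) ∶= n ∶+ (n ∶+ (i ∶+ j))) ≡.refl n i j)) ⟩
    fib (suc (n ℕ.+ (n ℕ.+ (i ℕ.+ j))))
      ≈⟨ fib-+ n (n ℕ.+ (i ℕ.+ j)) ⟩
    c′ * d′ + y * (a * d)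
      ≈⟨ +-identityʳ _ ⟨
    (c′ * d′ + y * (a * d)) + 0#
      -- The solver treats `y` and `z` as independent, so a multiple of `y + z` is inserted where
      -- the two must cancel.
      ≈⟨ +-congˡ (trans (*-congʳ (-‿inverseʳ y)) (zeroˡ t)) ⟨
    (c′ * d′ + y * (a * d)) + (y + z) * t
      ≈⟨ regroup y z _ _ _ _ ⟩
    (c′ * d′ + z * z ^ n * (fib i * fib j)) + y * (a * d + t) ∎)
    where
    open +-*-Solver using () renaming (_:+_ to _∶+_; _:=_ to _∶=_)
    a a′ b′ c′ d d′ t : Carrier
    a = fib n
    d = fib (n ℕ.+ (i ℕ.+ j))
    a′ = fib (suc (n ℕ.+ i))
    b′ = fib (suc (n ℕ.+ j))
    c′ = fib (suc n)
    d′ = fib (suc (n ℕ.+ (i ℕ.+ j)))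
    t = z ^ n * (fib i * fib j)
    regroup : ∀ y z u v w p → (u + y * v) + (y + z) * (w * p) ≈ (u + z * w * p) + y * (v + w * p)
    regroup = solve 6 (λ y z u v w p →
      (u :+ y :* v) :+ (y :+ z) :* (w :* p) := (u :+ z :* w :* p) :+ y :* (v :+ w :* p)) refl

  z*z≈y*y : z * z ≈ y * y
  z*z≈y*y = +-cancelʳ (y * z) _ _ (begin
    z * z + y * z ≈⟨ distribʳ z z y ⟨
    (z + y) * z   ≈⟨ trans (*-congʳ (-‿inverseˡ y)) (zeroˡ z) ⟩
    0#            ≈⟨ trans (*-congˡ (-‿inverseʳ y)) (zeroʳ y) ⟨
    y * (y + z)   ≈⟨ distribˡ y y z ⟩
    y * y + y * z ∎)

  -- Two-step induction on d for all m: the cases (d+1, m+1) and (d, m+2) have the same Fibonacci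
  -- factor F_{d+m+2} on the right, so the recurrence of L combines them.
  lucas*fib : ∀ d m → fib (d ℕ.+ (d ℕ.+ m)) + z ^ d * fib m ≈ lucas d * fib (d ℕ.+ m)
  lucas*fib zero m = trans (+-cong (sym (*-identityˡ _)) refl) (sym (distribʳ _ _ _))
  lucas*fib (suc zero) m = begin
    (x * fib (suc m) + y * fib m) + z * 1# * fib m ≈⟨ regroup _ _ _ _ _ ⟩
    x * fib (suc m) + (y + z * 1#) * fib m         ≈⟨ +-congˡ (*-congʳ (trans (+-congˡ (*-identityʳ z)) (-‿inverseʳ y))) ⟩
    x * fib (suc m) + 0# * fib m                   ≈⟨ trans (+-congˡ (zeroˡ _)) (+-identityʳ _) ⟩
    x * fib (suc m)                                ∎
    where
    regroup : ∀ u y f z g → (u + y * f) + z * g * f ≈ u + (y + z * g) * f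
    regroup = solve 5 (λ u y f z g → (u :+ y :* f) :+ z :* g :* f := u :+ (y :+ z :* g) :* f) refl
  lucas*fib (suc (suc d)) m = begin
    fib (2 ℕ.+ (d ℕ.+ (2 ℕ.+ (d ℕ.+ m)))) + z ^ (2 ℕ.+ d) * f₀
      ≈⟨ +-congʳ (+-cong (*-congˡ (fib-≡ i₁)) (*-congˡ (fib-≡ i₀))) ⟩
    (x * B + y * P) + z * (z * z ^ d) * f₀
      ≈⟨ +-congˡ (+-identityʳ _) ⟨
    (x * B + y * P) + (z * (z * z ^ d) * f₀ + 0#)
      ≈⟨ +-congˡ (+-congˡ (trans (*-congʳ (-‿inverseʳ y)) (zeroˡ _))) ⟨
    (x * B + y * P) + (z * (z * z ^ d) * f₀ + (y + z) * (z ^ d * (x * f₁)))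
      ≈⟨ regroup₁ x y z B P f₀ f₁ (z ^ d) ⟩
    (x * (B + z * z ^ d * f₁) + y * (P + z ^ d * (x * f₁))) + (z * z) * (z ^ d * f₀)
      ≈⟨ +-congˡ (*-congʳ z*z≈y*y) ⟩
    (x * (B + z * z ^ d * f₁) + y * (P + z ^ d * (x * f₁))) + (y * y) * (z ^ d * f₀)
      ≈⟨ regroup₂ x y z B P f₀ f₁ (z ^ d) ⟩
    x * (B + z ^ suc d * f₁) + y * (P + z ^ d * fib (2 ℕ.+ m))
      ≈⟨ +-cong (*-congˡ (lucas*fib (suc d) (suc m))) (*-congˡ (lucas*fib d (2 ℕ.+ m))) ⟩
    x * (lucas (suc d) * fib (suc d ℕ.+ suc m)) + y * (lucas d * fib (d ℕ.+ (2 ℕ.+ m)))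
      ≈⟨ +-cong (*-congˡ (*-congˡ (fib-≡ (≡.cong suc (ℕ.+-suc d m)))))
                (*-congˡ (*-congˡ (fib-≡ (≡.trans (ℕ.+-suc d (suc m)) (≡.cong suc (ℕ.+-suc d m)))))) ⟩
    x * (lucas (suc d) * fib (2 ℕ.+ d ℕ.+ m)) + y * (lucas d * fib (2 ℕ.+ d ℕ.+ m))
      ≈⟨ regroup₃ _ _ _ _ _ ⟩
    (x * lucas (suc d) + y * lucas d) * fib (2 ℕ.+ d ℕ.+ m) ∎
    where
    open +-*-Solver using (con) renaming (_:+_ to _∶+_; _:=_ to _∶=_)
    f₀ f₁ B P : Carrier
    f₀ = fib m
    f₁ = fib (suc m)
    B = fib (suc d ℕ.+ (suc d ℕ.+ suc m))
    P = fib (d ℕ.+ (d ℕ.+ (2 ℕ.+ m)))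
    i₁ : suc (d ℕ.+ (2 ℕ.+ (d ℕ.+ m))) ≡ suc d ℕ.+ (suc d ℕ.+ suc m)
    i₁ = +-*-Solver.solve 2 (λ d m → con 1 ∶+ (d ∶+ (con 2 ∶+ (d ∶+ m)))
           ∶= (con 1 ∶+ d) ∶+ ((con 1 ∶+ d) ∶+ (con 1 ∶+ m))) ≡.refl d m
    i₀ : d ℕ.+ (2 ℕ.+ (d ℕ.+ m)) ≡ d ℕ.+ (d ℕ.+ (2 ℕ.+ m))
    i₀ = +-*-Solver.solve 2 (λ d m → d ∶+ (con 2 ∶+ (d ∶+ m)) ∶= d ∶+ (d ∶+ (con 2 ∶+ m))) ≡.refl d m
    regroup₁ : ∀ x y z B P f₀ f₁ w →
      (x * B + y * P) + (z * (z * w) * f₀ + (y + z) * (w * (x * f₁)))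
        ≈ (x * (B + z * w * f₁) + y * (P + w * (x * f₁))) + (z * z) * (w * f₀)
    regroup₁ = solve 8 (λ x y z B P f₀ f₁ w →
      (x :* B :+ y :* P) :+ (z :* (z :* w) :* f₀ :+ (y :+ z) :* (w :* (x :* f₁)))
        := (x :* (B :+ z :* w :* f₁) :+ y :* (P :+ w :* (x :* f₁))) :+ (z :* z) :* (w :* f₀)) refl
    regroup₂ : ∀ x y z B P f₀ f₁ w →
      (x * (B + z * w * f₁) + y * (P + w * (x * f₁))) + (y * y) * (w * f₀)
        ≈ x * (B + z * w * f₁) + y * (P + w * (x * f₁ + y * f₀))
    regroup₂ = solve 8 (λ x y z B P f₀ f₁ w →
      (x :* (B :+ z :* w :* f₁) :+ y :* (P :+ w :* (x :* f₁))) :+ (y :* y) :* (w :* f₀)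
        := x :* (B :+ z :* w :* f₁) :+ y :* (P :+ w :* (x :* f₁ :+ y :* f₀))) refl
    regroup₃ : ∀ x y a b f → x * (a * f) + y * (b * f) ≈ (x * a + y * b) * f
    regroup₃ = solve 5 (λ x y a b f → x :* (a :* f) :+ y :* (b :* f) := (x :* a :+ y :* b) :* f) refl

  -- What remains of `rising-recurrence` without the common factor. Vajda's identity replaces the
  -- first product by one with F_{n+f+d}; as n+f = d+m, this index is 2d+m and `lucas*fib` applies.
  fib-quadratic : ∀ m n d f → d ℕ.+ m ≡ n ℕ.+ f →
    fib (n ℕ.+ d) * fib (n ℕ.+ f) + z ^ d * (fib m * fib n)
      ≈ lucas d * (fib (n ℕ.+ f) * fib n) + z ^ n * (fib f * fib d)
  fib-quadratic m n d f eq = begin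
    fib (n ℕ.+ d) * fib (n ℕ.+ f) + z ^ d * (fib m * fib n)
      ≈⟨ +-congʳ (trans (*-comm _ _) (vajda n f d)) ⟩
    (fib n * fib (n ℕ.+ (f ℕ.+ d)) + z ^ n * (fib f * fib d)) + z ^ d * (fib m * fib n)
      ≈⟨ +-congʳ (+-congʳ (*-congˡ (fib-≡ index))) ⟩
    (fib n * fib (d ℕ.+ (d ℕ.+ m)) + z ^ n * (fib f * fib d)) + z ^ d * (fib m * fib n)
      ≈⟨ regroup₁ _ _ _ _ _ ⟩
    (fib (d ℕ.+ (d ℕ.+ m)) + z ^ d * fib m) * fib n + z ^ n * (fib f * fib d)
      ≈⟨ +-congʳ (*-congʳ (trans (lucas*fib d m) (*-congˡ (fib-≡ eq)))) ⟩
    lucas d * fib (n ℕ.+ f) * fib n + z ^ n * (fib f * fib d)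
      ≈⟨ +-congʳ (*-assoc _ _ _) ⟩
    lucas d * (fib (n ℕ.+ f) * fib n) + z ^ n * (fib f * fib d) ∎
    where
    index : n ℕ.+ (f ℕ.+ d) ≡ d ℕ.+ (d ℕ.+ m)
    index = ≡.trans (≡.sym (ℕ.+-assoc n f d)) (≡.trans (ℕ.+-comm (n ℕ.+ f) d) (≡.cong (d ℕ.+_) (≡.sym eq)))
    regroup₁ : ∀ n u v w m → (n * u + v) + w * (m * n) ≈ (u + w * m) * n + v
    regroup₁ = solve 5 (λ n u v w m → (n :* u :+ v) :+ w :* (m :* n) := (u :+ w :* m) :* n :+ v) refl

  -- The numerator of the fibopolynomial with upper entry M+k-1 and lower entry k, and for M = 1 its
  -- denominator.
  rising : ℕ → ℕ → ℕ → Carrier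
  rising s M zero    = 1#
  rising s M (suc k) = fib (s ℕ.* (M ℕ.+ k)) * rising s M k

  rising-front : ∀ s M k → rising s M (suc k) ≈ fib (s ℕ.* M) * rising s (suc M) k
  rising-front s M zero    = *-congʳ (fib-≡ (≡.cong (s ℕ.*_) (ℕ.+-identityʳ M)))
  rising-front s M (suc k) = begin
    fib (s ℕ.* (M ℕ.+ suc k)) * rising s M (suc k)
      ≈⟨ *-cong (fib-≡ (≡.cong (s ℕ.*_) (ℕ.+-suc M k))) (rising-front s M k) ⟩
    fib (s ℕ.* (suc M ℕ.+ k)) * (fib (s ℕ.* M) * rising s (suc M) k)
      ≈⟨ regroup _ _ _ ⟩
    fib (s ℕ.* M) * (fib (s ℕ.* (suc M ℕ.+ k)) * rising s (suc M) k) ∎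
    where
    regroup : ∀ a b d → a * (b * d) ≈ b * (a * d)
    regroup = solve 3 (λ a b d → a :* (b :* d) := b :* (a :* d)) refl

  rising₀ : ∀ s k → rising s 0 (suc k) ≈ 0#
  rising₀ s k = trans (rising-front s 0 k) (trans (*-congʳ (fib-≡ (ℕ.*-zeroʳ s))) (zeroˡ _))

  -- The counterpart of `dividedSolution-recurrence`: its inhomogeneity has two factors fewer, as
  -- deleting a node lowers r by 2. The products of length k+2 all contain `rising s (2 + M) k`.
  rising-recurrence : ∀ s k M →
    rising s (2 ℕ.+ M) (2 ℕ.+ k) + z ^ (s ℕ.* (2 ℕ.+ k)) * rising s M (2 ℕ.+ k)
      ≈ lucas (s ℕ.* (2 ℕ.+ k)) * rising s (1 ℕ.+ M) (2 ℕ.+ k)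
        + z ^ (s ℕ.* suc M) * (fib (s ℕ.* suc k) * fib (s ℕ.* (2 ℕ.+ k)) * rising s (2 ℕ.+ M) k)
  rising-recurrence s k M = begin
    fib (s ℕ.* (2 ℕ.+ M ℕ.+ suc k)) * (fib (s ℕ.* (2 ℕ.+ M ℕ.+ k)) * r) + z ^ d * rising s M (2 ℕ.+ k)
      ≈⟨ +-cong (*-cong (fib-≡ index₁) (*-congʳ (fib-≡ index₂)))
                (*-congˡ (trans (rising-front s M (suc k)) (*-congˡ (rising-front s (suc M) k)))) ⟩
    fib (n ℕ.+ d) * (fib (n ℕ.+ f) * r) + z ^ d * (fib m * (fib n * r))
      ≈⟨ regroup₁ _ _ _ _ _ _ ⟩
    (fib (n ℕ.+ d) * fib (n ℕ.+ f) + z ^ d * (fib m * fib n)) * r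
      ≈⟨ *-congʳ (fib-quadratic m n d f index₃) ⟩
    (lucas d * (fib (n ℕ.+ f) * fib n) + z ^ n * (fib f * fib d)) * r
      ≈⟨ regroup₂ _ _ _ _ _ _ ⟩
    lucas d * (fib (n ℕ.+ f) * (fib n * r)) + z ^ n * (fib f * fib d * r)
      ≈⟨ +-congʳ (*-congˡ (*-cong (fib-≡ (≡.sym (ℕ.*-distribˡ-+ s (suc M) (suc k)))) (sym (rising-front s (suc M) k)))) ⟩
    lucas d * (fib (s ℕ.* (suc M ℕ.+ suc k)) * rising s (suc M) (suc k)) + z ^ n * (fib f * fib d * r) ∎
    where
    open +-*-Solver using (con) renaming (_:+_ to _∶+_; _:*_ to _∶*_; _:=_ to _∶=_)
    r : Carrier
    r = rising s (2 ℕ.+ M) k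
    m n d f : ℕ
    m = s ℕ.* M
    n = s ℕ.* suc M
    d = s ℕ.* (2 ℕ.+ k)
    f = s ℕ.* suc k
    index₁ : s ℕ.* (2 ℕ.+ M ℕ.+ suc k) ≡ n ℕ.+ d
    index₁ = +-*-Solver.solve 3 (λ s M k → s ∶* (con 2 ∶+ M ∶+ (con 1 ∶+ k))
               ∶= s ∶* (con 1 ∶+ M) ∶+ s ∶* (con 2 ∶+ k)) ≡.refl s M k
    index₂ : s ℕ.* (2 ℕ.+ M ℕ.+ k) ≡ n ℕ.+ f
    index₂ = +-*-Solver.solve 3 (λ s M k → s ∶* (con 2 ∶+ M ∶+ k)
               ∶= s ∶* (con 1 ∶+ M) ∶+ s ∶* (con 1 ∶+ k)) ≡.refl s M k
    index₃ : d ℕ.+ m ≡ n ℕ.+ f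
    index₃ = +-*-Solver.solve 3 (λ s M k → s ∶* (con 2 ∶+ k) ∶+ s ∶* M
               ∶= s ∶* (con 1 ∶+ M) ∶+ s ∶* (con 1 ∶+ k)) ≡.refl s M k
    regroup₁ : ∀ a b r w p q → a * (b * r) + w * (p * (q * r)) ≈ (a * b + w * (p * q)) * r
    regroup₁ = solve 6 (λ a b r w p q → a :* (b :* r) :+ w :* (p :* (q :* r)) := (a :* b :+ w :* (p :* q)) :* r) refl
    regroup₂ : ∀ l a b w t r → (l * (a * b) + w * t) * r ≈ l * (a * (b * r)) + w * (t * r)
    regroup₂ = solve 6 (λ l a b w t r → (l :* (a :* b) :+ w :* t) :* r := l :* (a :* (b :* r)) :+ w :* (t :* r)) refl

  -- The induction on the number of nodes.

  private
    -- With (z ^ s) ^ j in place of z ^ (s * j), raising `p` and `j` together multiplies the node by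
    -- z ^ s by mere unfolding and reassociation.
    node : ∀ s c p → ℕ → Carrier
    node s c p j = (z ^ s) ^ j * lucas (s ℕ.* ((p ∸ j) ℕ.* 2 ℕ.+ c))

  -- The nodes carry a scale g because deleting the first of them multiplies the remaining family by z ^ s.
  interpolation : ∀ s c δ → rising s 0 c ≈ 0# →
    (∀ M → rising s (2 ℕ.+ M) c + z ^ (s ℕ.* c) * rising s M c
             ≈ lucas (s ℕ.* c) * rising s (1 ℕ.+ M) c + δ * ((z ^ s) ^ suc M * rising s 1 c)) →
    ∀ p g {e w : Fin (suc p) → Carrier} {Q f} → Weights p e w →
    (∀ j → e j ≈ g * node s c p (toℕ j)) →
    Q ≈ g * g * z ^ (s ℕ.* (p ℕ.* 2 ℕ.+ c)) →
    (∀ N → f N ≈ δ * (g * (z ^ s) ^ suc p) ^ suc N) →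
    (∀ N → N ≤ p → dividedSolution e w Q f N ≈ 0#) ×
    (∀ M → dividedSolution e w Q f (suc (M ℕ.+ p)) * rising s 1 (p ℕ.* 2 ℕ.+ c)
             ≈ g ^ M * rising s (suc M) (p ℕ.* 2 ℕ.+ c))
  -- A single node has weight 1, so `C` is `solution` itself; `R-rec` is the unscaled recurrence for
  -- products of c factors.
  interpolation s c δ R₀≈0 R-rec zero g {e} {w} {Q} {f} W e≈ Q≈ f≈ =
    (λ { .0 z≤n → dividedSolution₀ e w Q f }) ,
    scaled-unique
      (trans (*-congʳ (dividedSolution₀ e w Q f)) (zeroˡ _))
      R₀≈0
      (trans (*-congʳ (C≈u 1)) (*-identityˡ _))
      X-rec R-rec
    where
    D q l E : Carrier
    D = rising s 1 c
    q = z ^ s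
    l = lucas (s ℕ.* c)
    E = z ^ (s ℕ.* c)
    C u : ℕ → Carrier
    C = dividedSolution e w Q f
    u = solution (e Fin.zero) Q f

    C≈u : ∀ N → C N ≈ u N
    C≈u N = trans (+-identityʳ _) (trans (*-congʳ (trans (sym (*-identityʳ _)) (W Fin.zero))) (*-identityˡ _))

    f*D : ∀ N → f N * D ≈ g ^ suc N * (δ * (q ^ suc N * D))
    f*D N = begin
      f N * D                                ≈⟨ *-congʳ (f≈ N) ⟩
      δ * (g * (q * 1#)) ^ suc N * D         ≈⟨ *-congʳ (*-congˡ (^-congˡ (suc N) (*-congˡ (*-identityʳ q)))) ⟩
      δ * (g * q) ^ suc N * D                ≈⟨ *-congʳ (*-congˡ (^-distrib-* g q (suc N))) ⟩
      δ * (g ^ suc N * q ^ suc N) * D        ≈⟨ regroup _ _ _ _ ⟩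
      g ^ suc N * (δ * (q ^ suc N * D))      ∎
      where
      regroup : ∀ δ a b d → δ * (a * b) * d ≈ a * (δ * (b * d))
      regroup = solve 4 (λ δ a b d → δ :* (a :* b) :* d := a :* (δ :* (b :* d))) refl

    X-rec : ∀ N → C (2 ℕ.+ (N ℕ.+ 0)) * D + (g * g * E) * (C (N ℕ.+ 0) * D)
                    ≈ (g * l) * (C (1 ℕ.+ (N ℕ.+ 0)) * D) + g ^ suc N * (δ * (q ^ suc N * D))
    X-rec N = begin
      C (2 ℕ.+ (N ℕ.+ 0)) * D + (g * g * E) * (C (N ℕ.+ 0) * D)
        ≈⟨ +-cong (*-congʳ (C≈u (2 ℕ.+ (N ℕ.+ 0)))) (*-cong (sym Q≈) (*-congʳ (C≈u (N ℕ.+ 0)))) ⟩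
      u (2 ℕ.+ (N ℕ.+ 0)) * D + Q * (u (N ℕ.+ 0) * D)
        ≈⟨ collect _ _ _ _ ⟩
      (u (2 ℕ.+ (N ℕ.+ 0)) + Q * u (N ℕ.+ 0)) * D
        ≈⟨ *-congʳ (solution-recurrence (e Fin.zero) Q f (N ℕ.+ 0)) ⟩
      (e Fin.zero * u (1 ℕ.+ (N ℕ.+ 0)) + f (N ℕ.+ 0)) * D
        ≈⟨ distribute _ _ _ _ ⟩
      e Fin.zero * (u (1 ℕ.+ (N ℕ.+ 0)) * D) + f (N ℕ.+ 0) * D
        ≈⟨ +-cong (*-cong (trans (e≈ Fin.zero) (*-congˡ (*-identityˡ l))) (*-congʳ (sym (C≈u (1 ℕ.+ (N ℕ.+ 0))))))
                  (trans (*-congʳ (reflexive (≡.cong f (ℕ.+-identityʳ N)))) (f*D N)) ⟩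
      (g * l) * (C (1 ℕ.+ (N ℕ.+ 0)) * D) + g ^ suc N * (δ * (q ^ suc N * D)) ∎
      where
      collect : ∀ a d Q b → a * d + Q * (b * d) ≈ (a + Q * b) * d
      collect = solve 4 (λ a d Q b → a :* d :+ Q :* (b :* d) := (a :+ Q :* b) :* d) refl
      distribute : ∀ e u f d → (e * u + f) * d ≈ e * (u * d) + f * d
      distribute = solve 4 (λ e u f d → (e :* u :+ f) :* d := e :* (u :* d) :+ f :* d) refl

  interpolation s c δ R₀≈0 R-rec (suc p) g {e} {w} {Q} {f} W e≈ Q≈ f≈ = vanish , scaled-unique
      (trans (*-congʳ (vanish (suc p) ℕ.≤-refl)) (zeroˡ _))
      (rising₀ s (suc k))
      X₁≈Y₁
      X-rec Y-rec
    where
    k : ℕ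
    k = p ℕ.* 2 ℕ.+ c
    q l E K D : Carrier
    q = z ^ s
    l = lucas (s ℕ.* (2 ℕ.+ k))
    E = z ^ (s ℕ.* (2 ℕ.+ k))
    K = fib (s ℕ.* suc k) * fib (s ℕ.* (2 ℕ.+ k))
    D = rising s 1 (2 ℕ.+ k)
    C C′ : ℕ → Carrier
    C  = dividedSolution e w Q f
    C′ = dividedSolution (e ∘ Fin.suc) (reweight Fin.zero e w) Q f

    -- Deleting a node leaves Q and f unchanged: what the smaller `p` loses, the larger scale g q
    -- restores.
    Q≈′ : Q ≈ (g * q) * (g * q) * z ^ (s ℕ.* k)
    Q≈′ = begin
      Q                                                ≈⟨ Q≈ ⟩
      g * g * z ^ (s ℕ.* (2 ℕ.+ k))                    ≈⟨ *-congˡ (z^-≡ index) ⟩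
      g * g * z ^ (s ℕ.+ (s ℕ.+ s ℕ.* k))              ≈⟨ *-congˡ (trans (^-homo-* z s _) (*-congˡ (^-homo-* z s _))) ⟩
      g * g * (q * (q * z ^ (s ℕ.* k)))                ≈⟨ regroup _ _ _ ⟩
      (g * q) * (g * q) * z ^ (s ℕ.* k)                ∎
      where
      index : s ℕ.* (2 ℕ.+ k) ≡ s ℕ.+ (s ℕ.+ s ℕ.* k)
      index = ≡.trans (ℕ.*-suc s (suc k)) (≡.cong (s ℕ.+_) (ℕ.*-suc s k))
      regroup : ∀ g q e → g * g * (q * (q * e)) ≈ (g * q) * (g * q) * e
      regroup = solve 3 (λ g q e → g :* g :* (q :* (q :* e)) := (g :* q) :* (g :* q) :* e) refl

    rotate : ∀ g q n l → g * (q * n * l) ≈ (g * q) * (n * l)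
    rotate = solve 4 (λ g q n l → g :* (q :* n :* l) := (g :* q) :* (n :* l)) refl

    IH : (∀ N → N ≤ p → C′ N ≈ 0#) × (∀ M → C′ (suc (M ℕ.+ p)) * rising s 1 k ≈ (g * q) ^ M * rising s (suc M) k)
    IH = interpolation s c δ R₀≈0 R-rec p (g * q) (Weights-remove₀ {e = e} W)
           (λ j → trans (e≈ (Fin.suc j)) (rotate _ _ _ _)) Q≈′
           (λ N → trans (f≈ N) (*-congˡ (^-congˡ (suc N) (sym (*-assoc g q _)))))

    C-rec : ∀ N → C (2 ℕ.+ N) + (g * g * E) * C N ≈ (g * l) * C (1 ℕ.+ N) + C′ (1 ℕ.+ N)
    C-rec N = trans (+-congˡ (*-congʳ (sym Q≈))) (trans (dividedSolution-recurrence {e = e} Q f W N)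
      (+-congʳ (*-congʳ (trans (e≈ Fin.zero) (*-congˡ (*-identityˡ l))))))

    drop-zeros : ∀ {a b u t} → a ≈ 0# → b ≈ 0# → ∀ {v} → v + u * a ≈ t * b + 0# → v ≈ 0#
    drop-zeros a≈0 b≈0 eq = trans (sym (trans (+-congˡ (trans (*-congˡ a≈0) (zeroʳ _))) (+-identityʳ _)))
      (trans eq (trans (+-identityʳ _) (trans (*-congˡ b≈0) (zeroʳ _))))

    -- At index N + 2 the recurrence involves `C′ (1 + N)`, so `C` has one zero more than `C′`.
    vanish : ∀ N → N ≤ suc p → C N ≈ 0#
    vanish zero          _             = dividedSolution₀ e w Q f
    vanish (suc zero)    _             = dividedSolution₁ {e = e} Q f W
    vanish (suc (suc N)) (s≤s 1+N≤p)   = drop-zeros (vanish N (ℕ.m≤n⇒m≤1+n (ℕ.<⇒≤ 1+N≤p))) (vanish (suc N) (ℕ.m≤n⇒m≤1+n 1+N≤p))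
      (trans (C-rec N) (+-congˡ (proj₁ IH (suc N) 1+N≤p)))

    D≈ : D ≈ K * rising s 1 k
    D≈ = regroup _ _ _
      where
      regroup : ∀ a b r → a * (b * r) ≈ (b * a) * r
      regroup = solve 3 (λ a b r → a :* (b :* r) := (b :* a) :* r) refl

    C′*D : ∀ M → C′ (suc (M ℕ.+ p)) * D ≈ K * ((g * q) ^ M * rising s (suc M) k)
    C′*D M = begin
      C′ (suc (M ℕ.+ p)) * D                     ≈⟨ *-congˡ D≈ ⟩
      C′ (suc (M ℕ.+ p)) * (K * rising s 1 k)    ≈⟨ regroup _ _ _ ⟩
      K * (C′ (suc (M ℕ.+ p)) * rising s 1 k)    ≈⟨ *-congˡ (proj₂ IH M) ⟩
      K * ((g * q) ^ M * rising s (suc M) k)   ∎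
      where
      regroup : ∀ a b d → a * (b * d) ≈ b * (a * d)
      regroup = solve 3 (λ a b d → a :* (b :* d) := b :* (a :* d)) refl

    X Y r : ℕ → Carrier
    -- The shift puts the last forced zero of `C` at index 0, where `Y` vanishes too.
    X M = C (M ℕ.+ suc p) * D
    Y M = rising s M (2 ℕ.+ k)
    r N = z ^ (s ℕ.* suc N) * (K * rising s (2 ℕ.+ N) k)

    Y-rec : ∀ N → Y (2 ℕ.+ N) + E * Y N ≈ l * Y (1 ℕ.+ N) + r N
    Y-rec = rising-recurrence s k

    shifted-rec : ∀ N → X (2 ℕ.+ N) + (g * g * E) * X N ≈ (g * l) * X (1 ℕ.+ N) + C′ (suc (suc N ℕ.+ p)) * D
    shifted-rec N = begin
      C (2 ℕ.+ (N ℕ.+ suc p)) * D + (g * g * E) * (C (N ℕ.+ suc p) * D)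
        ≈⟨ collect _ _ _ _ ⟩
      (C (2 ℕ.+ (N ℕ.+ suc p)) + (g * g * E) * C (N ℕ.+ suc p)) * D
        ≈⟨ *-congʳ (C-rec (N ℕ.+ suc p)) ⟩
      ((g * l) * C (1 ℕ.+ (N ℕ.+ suc p)) + C′ (1 ℕ.+ (N ℕ.+ suc p))) * D
        ≈⟨ *-congʳ (+-congˡ (reflexive (≡.cong (C′ ∘ suc) (ℕ.+-suc N p)))) ⟩
      ((g * l) * C (1 ℕ.+ (N ℕ.+ suc p)) + C′ (suc (suc N ℕ.+ p))) * D
        ≈⟨ distribute _ _ _ _ ⟩
      (g * l) * (C (1 ℕ.+ (N ℕ.+ suc p)) * D) + C′ (suc (suc N ℕ.+ p)) * D ∎
      where
      collect : ∀ a d Q b → a * d + Q * (b * d) ≈ (a + Q * b) * d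
      collect = solve 4 (λ a d Q b → a :* d :+ Q :* (b :* d) := (a :+ Q :* b) :* d) refl
      distribute : ∀ e u f d → (e * u + f) * d ≈ e * (u * d) + f * d
      distribute = solve 4 (λ e u f d → (e :* u :+ f) :* d := e :* (u :* d) :+ f :* d) refl

    X-rec : ∀ N → X (2 ℕ.+ N) + (g * g * E) * X N ≈ (g * l) * X (1 ℕ.+ N) + g ^ suc N * r N
    X-rec N = trans (shifted-rec N) (+-congˡ (begin
      C′ (suc (suc N ℕ.+ p)) * D
        ≈⟨ C′*D (suc N) ⟩
      K * ((g * q) ^ suc N * rising s (2 ℕ.+ N) k)
        ≈⟨ *-congˡ (*-congʳ (trans (^-distrib-* g q (suc N)) (*-congˡ (^-assocʳ z s (suc N))))) ⟩
      K * ((g ^ suc N * z ^ (s ℕ.* suc N)) * rising s (2 ℕ.+ N) k)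
        ≈⟨ regroup _ _ _ _ ⟩
      g ^ suc N * r N ∎))
      where
      regroup : ∀ K a b r → K * ((a * b) * r) ≈ a * (b * (K * r))
      regroup = solve 4 (λ K a b r → K :* ((a :* b) :* r) := a :* (b :* (K :* r))) refl

    -- After the zeros `C p` and `C (suc p)`, the recurrence reduces to C (2 + p) = C′ (1 + p),
    -- which the induction hypothesis evaluates.
    X₁≈Y₁ : X 1 ≈ Y 1
    X₁≈Y₁ = begin
      C (2 ℕ.+ p) * D
        ≈⟨ *-congʳ (trans (sym (+-identityʳ _)) (+-congˡ (sym (trans (*-congˡ (vanish p (ℕ.n≤1+n p))) (zeroʳ _))))) ⟩
      (C (2 ℕ.+ p) + (g * g * E) * C p) * D
        ≈⟨ *-congʳ (C-rec p) ⟩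
      ((g * l) * C (suc p) + C′ (suc p)) * D
        ≈⟨ *-congʳ (trans (+-congʳ (trans (*-congˡ (vanish (suc p) ℕ.≤-refl)) (zeroʳ _))) (+-identityˡ _)) ⟩
      C′ (suc p) * D
        ≈⟨ C′*D 0 ⟩
      K * (1# * rising s 1 k)
        ≈⟨ *-congˡ (*-identityˡ _) ⟩
      K * rising s 1 k
        ≈⟨ D≈ ⟨
      D ∎

  -- Inverses, negative indices and the solution at a node.

  1^n≈1 : ∀ n → 1# ^ n ≈ 1#
  1^n≈1 zero    = refl
  1^n≈1 (suc n) = trans (*-identityˡ _) (1^n≈1 n)

  *-inv : ∀ {a} (a#0 : a # 0#) → a * inv a a#0 ≈ 1#
  *-inv {a} a#0 = trans (*-congʳ (sym (x-0≈x a))) (proj₂ (proj₂ (#⇒invertible a#0)))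

  ∏-except-punchIn : ∀ {n} (j : Fin (suc n)) f → ∏-except j f ≈ ∏[ i < n ] f (punchIn j i)
  ∏-except-punchIn         Fin.zero    f = *-identityˡ _
  ∏-except-punchIn {suc n} (Fin.suc j) f = *-congˡ (∏-except-punchIn j (f ∘ Fin.suc))

  ∏-zero : ∀ k {f : Fin k → Carrier} i → f i ≈ 0# → ∏ k f ≈ 0#
  ∏-zero (suc k) Fin.zero    fᵢ≈0 = trans (*-congʳ fᵢ≈0) (zeroˡ _)
  ∏-zero (suc k) (Fin.suc i) fᵢ≈0 = trans (*-congˡ (∏-zero k i fᵢ≈0)) (zeroʳ _)

  [-y]^-neg : ∀ n → [-y]^ (ℤ.- pos n) ≈ inv z -y#0 ^ n
  [-y]^-neg zero    = refl
  [-y]^-neg (suc n) = refl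

  F-neg : ∀ n → F (ℤ.- pos n) ≈ - (inv z -y#0 ^ n * fib n)
  F-neg zero    = sym (trans (-‿cong (zeroʳ 1#)) -0#≈0#)
  F-neg (suc n) = refl

  inv^*z^ : ∀ n → inv z -y#0 ^ n * z ^ n ≈ 1#
  inv^*z^ n = begin
    inv z -y#0 ^ n * z ^ n ≈⟨ ^-distrib-* _ _ n ⟨
    (inv z -y#0 * z) ^ n   ≈⟨ ^-congˡ n (trans (*-comm _ _) (*-inv -y#0)) ⟩
    1# ^ n                 ≈⟨ 1^n≈1 n ⟩
    1#                     ∎

  inv^*z^-cancel : ∀ m n → inv z -y#0 ^ (m ℕ.+ n) * z ^ n ≈ inv z -y#0 ^ m
  inv^*z^-cancel m n = begin
    inv z -y#0 ^ (m ℕ.+ n) * z ^ n                  ≈⟨ *-congʳ (^-homo-* _ m n) ⟩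
    inv z -y#0 ^ m * inv z -y#0 ^ n * z ^ n         ≈⟨ *-assoc _ _ _ ⟩
    inv z -y#0 ^ m * (inv z -y#0 ^ n * z ^ n)       ≈⟨ *-congˡ (inv^*z^ n) ⟩
    inv z -y#0 ^ m * 1#                             ≈⟨ *-identityʳ _ ⟩
    inv z -y#0 ^ m                                  ∎

  -- `lucas*fib` at m = Nd is a recurrence for F_{Nd}. Scaling by z^a turns its coefficient L_d into
  -- the node and (-y)^d into Q.
  solution-fib : ∀ a d {Q} → Q ≈ z ^ a * z ^ a * z ^ d → ∀ N →
    solution (z ^ a * lucas d) Q (λ _ → 0#) (suc N) * fib d ≈ (z ^ a) ^ N * fib (suc N ℕ.* d)
  solution-fib a d {Q} Q≈ = scaled-unique {Y = λ N → fib (N ℕ.* d)} {r = λ _ → 0#}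
    (zeroˡ _) refl (trans (*-identityˡ _) (fib-≡ (≡.sym (ℕ.+-identityʳ d))))
    X-rec (λ N → trans (lucas*fib d (N ℕ.* d)) (sym (+-identityʳ _)))
    where
    u : ℕ → Carrier
    u = solution (z ^ a * lucas d) Q (λ _ → 0#)
    X-rec : ∀ N → u (2 ℕ.+ N) * fib d + (z ^ a * z ^ a * z ^ d) * (u N * fib d)
                    ≈ (z ^ a * lucas d) * (u (1 ℕ.+ N) * fib d) + (z ^ a) ^ suc N * 0#
    X-rec N = begin
      u (2 ℕ.+ N) * fib d + (z ^ a * z ^ a * z ^ d) * (u N * fib d)
        ≈⟨ +-congˡ (*-congʳ Q≈) ⟨
      u (2 ℕ.+ N) * fib d + Q * (u N * fib d)
        ≈⟨ collect _ _ _ _ ⟩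
      (u (2 ℕ.+ N) + Q * u N) * fib d
        ≈⟨ *-congʳ (trans (solution-recurrence _ Q _ N) (+-identityʳ _)) ⟩
      (z ^ a * lucas d) * u (1 ℕ.+ N) * fib d
        ≈⟨ *-assoc _ _ _ ⟩
      (z ^ a * lucas d) * (u (1 ℕ.+ N) * fib d)
        ≈⟨ trans (+-congˡ (zeroʳ _)) (+-identityʳ _) ⟨
      (z ^ a * lucas d) * (u (1 ℕ.+ N) * fib d) + (z ^ a) ^ suc N * 0# ∎
      where
      collect : ∀ a d Q b → a * d + Q * (b * d) ≈ (a + Q * b) * d
      collect = solve 4 (λ a d Q b → a :* d :+ Q :* (b :* d) := (a :+ Q :* b) :* d) refl

  -- Fibopolynomials as values of an interpolating sequence.

  module _ (s : ℕ) where

    fallingProduct : ℕ → ℕ → Carrier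
    fallingProduct n k = ∏[ i < k ] F (pos s ℤ.* (pos n ℤ.- pos (toℕ i)))

    -- The factor with i = n is F_0.
    fallingProduct-zero : ∀ {n} k → n < k → fallingProduct n k ≈ 0#
    fallingProduct-zero {n} k n<k = ∏-zero k (Fin.fromℕ< n<k) (reflexive (≡.cong F (≡.trans
      (≡.cong (λ i → pos s ℤ.* (pos n ℤ.- pos i)) (Fin.toℕ-fromℕ< n<k))
      (≡.trans (≡.cong (pos s ℤ.*_) (ℤ.+-inverseʳ (pos n))) (ℤ.*-zeroʳ (pos s))))))

    fallingProduct-rising : ∀ {n} k M → k ℕ.+ M ≡ suc n → fallingProduct n k ≈ rising s M k
    fallingProduct-rising {n} k M k+M≡1+n = trans (product-cong {k} factor) (descending k)
      where
      factor : ∀ (i : Fin k) → F (pos s ℤ.* (pos n ℤ.- pos (toℕ i))) ≈ fib (s ℕ.* (k ℕ.+ M ∸ suc (toℕ i)))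
      factor i = reflexive (≡.cong F (≡.trans
        (≡.cong (pos s ℤ.*_) (≡.trans (ℤ.m-n≡m⊖n n (toℕ i)) (ℤ.⊖-≥ i≤n)))
        (≡.trans (≡.sym (ℤ.pos-* s (n ∸ toℕ i)))
          (≡.cong (λ m → pos (s ℕ.* (m ∸ suc (toℕ i)))) (≡.sym k+M≡1+n)))))
        where
        i≤n : toℕ i ≤ n
        i≤n = ℕ.≤-pred (≡.subst (suc (toℕ i) ≤_) k+M≡1+n (ℕ.m≤n⇒m≤n+o M (Fin.toℕ<n i)))
      descending : ∀ k → ∏[ i < k ] fib (s ℕ.* (k ℕ.+ M ∸ suc (toℕ i))) ≈ rising s M k
      descending zero    = refl
      descending (suc k) = *-cong (fib-≡ (≡.cong (s ℕ.*_) (ℕ.+-comm k M))) (descending k)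

    ascendingProduct-rising : ∀ k M → ∏[ i < k ] F (pos (s ℕ.* (M ℕ.+ toℕ i))) ≈ rising s M k
    ascendingProduct-rising zero    M = refl
    ascendingProduct-rising (suc k) M = trans
      (*-cong (fib-≡ (≡.cong (s ℕ.*_) (ℕ.+-identityʳ M)))
        (trans (product-cong {k} (λ i → fib-≡ (≡.cong (s ℕ.*_) (ℕ.+-suc M (toℕ i))))) (ascendingProduct-rising k (suc M))))
      (sym (rising-front s M k))

    denominator#0 : ℕ → Set ℓ₂
    denominator#0 k = (∏[ i < k ] F (pos (s ℕ.* suc (toℕ i)))) # 0#

    fibopoly : ∀ n k → denominator#0 k → Carrier
    fibopoly n k k#0 = fallingProduct n k / (∏[ i < k ] F (pos (s ℕ.* suc (toℕ i)))) [ k#0 ]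

    fibopoly-zero : ∀ {n} k k#0 → n < k → fibopoly n k k#0 ≈ 0#
    fibopoly-zero k k#0 n<k = trans (*-congʳ (fallingProduct-zero k n<k)) (zeroˡ _)

    fibopoly-unique : ∀ {n} k M {C} k#0 → k ℕ.+ M ≡ suc n → C * rising s 1 k ≈ rising s M k →
                      fibopoly n k k#0 ≈ C
    fibopoly-unique {n} k M {C} k#0 k+M≡1+n eq = begin
      fallingProduct n k * i                ≈⟨ *-congʳ (fallingProduct-rising k M k+M≡1+n) ⟩
      rising s M k * i                      ≈⟨ *-congʳ eq ⟨
      C * rising s 1 k * i                  ≈⟨ *-congʳ (*-congˡ (ascendingProduct-rising k 1)) ⟨
      C * (∏[ i < k ] F (pos (s ℕ.* suc (toℕ i)))) * i ≈⟨ *-assoc _ _ _ ⟩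
      C * ((∏[ i < k ] F (pos (s ℕ.* suc (toℕ i)))) * i) ≈⟨ *-congˡ (*-inv k#0) ⟩
      C * 1#                                ≈⟨ *-identityʳ C ⟩
      C                                     ∎
      where
      i : Carrier
      i = inv _ k#0

    -- The conclusion of `interpolation` at scale g = 1, with `1# ^ M` kept so that it applies
    -- verbatim.
    Interpolates : ℕ → ℕ → (ℕ → Carrier) → Set ℓ₁
    Interpolates c p C = (∀ N → N ≤ p → C N ≈ 0#) ×
      (∀ M → C (suc (M ℕ.+ p)) * rising s 1 (p ℕ.* 2 ℕ.+ c) ≈ 1# ^ M * rising s (suc M) (p ℕ.* 2 ℕ.+ c))

    -- With n = N+p+c-1 and k = 2p+c, the upper entry lies below the lower one exactly for N ≤ p,
    -- the range in which `C` is known to vanish.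
    fibopoly-interpolates : ∀ {c p C} n k N k#0 → Interpolates c p C → k ≡ p ℕ.* 2 ℕ.+ c →
      suc n ≡ N ℕ.+ p ℕ.+ c → fibopoly n k k#0 ≈ C N
    fibopoly-interpolates {c} {p} {C} n k N k#0 (low , high) ≡.refl 1+n≡ with N ℕ.≤? p
    ... | yes N≤p = trans (fibopoly-zero _ k#0 n<k) (sym (low N N≤p))
      where
      n<k : n < p ℕ.* 2 ℕ.+ c
      n<k = ≡.subst (_≤ p ℕ.* 2 ℕ.+ c) (≡.sym 1+n≡) (ℕ.+-monoˡ-≤ c
        (≡.subst (N ℕ.+ p ≤_) (+-*-Solver.solve 1 (λ p → p ∶+ p ∶= p ∶* con 2) ≡.refl p) (ℕ.+-monoˡ-≤ p N≤p)))
        where open +-*-Solver using (con) renaming (_:+_ to _∶+_; _:*_ to _∶*_; _:=_ to _∶=_)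
    ... | no  N≰p with N ∸ suc p | ℕ.m∸n+n≡m (ℕ.≰⇒> N≰p)
    ...   | M | ≡.refl = fibopoly-unique _ (suc M) k#0 index (trans
      (*-congʳ (reflexive (≡.cong C (ℕ.+-suc M p)))) (trans (high M) (trans (*-congʳ (1^n≈1 M)) (*-identityˡ _))))
      where
      open +-*-Solver using (con) renaming (_:+_ to _∶+_; _:*_ to _∶*_; _:=_ to _∶=_)
      index : p ℕ.* 2 ℕ.+ c ℕ.+ suc M ≡ suc n
      index = ≡.trans (+-*-Solver.solve 3 (λ p c M → p ∶* con 2 ∶+ c ∶+ (con 1 ∶+ M) ∶= M ∶+ (con 1 ∶+ p) ∶+ p ∶+ c)
                ≡.refl p c M) (≡.sym 1+n≡)

  -- The sums of the theorem as divided differences.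

  module PartialFractions (s c p : ℕ) (D : Fin (suc p) → ℕ)
    (D≡ : ∀ j → D j ≡ s ℕ.* ((p ∸ toℕ j) ℕ.* 2 ℕ.+ c)) where

    e : Fin (suc p) → Carrier
    e j = [-y]^ pos (s ℕ.* toℕ j) * L (pos (D j))

    -- This unfolds to `𝒫` or `ℛ`, since `D` will be the index expression of the theorem itself;
    -- `D≡` gives access to its uniform form.
    W : Fin (suc p) → Carrier
    W j = ∏-except j (λ i → e j - e i)

    module _ (den#0 : ∀ j → (W j * F (pos (D j))) # 0#) where

      r : ℕ
      r = s ℕ.* (p ℕ.* 2 ℕ.+ c)

      i : Fin (suc p) → Carrier
      i j = inv _ (den#0 j)

      -- The inverse of `W j`, obtained from that of the full denominator `W j * F (pos (D j))`.
      w : Fin (suc p) → Carrier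
      w j = fib (D j) * i j

      w-weights : Weights p e w
      w-weights j = begin
        fib (D j) * i j * (∏[ k < p ] (e j - e (punchIn j k))) ≈⟨ *-congˡ (∏-except-punchIn j (λ k → e j - e k)) ⟨
        fib (D j) * i j * W j                                  ≈⟨ regroup _ _ _ ⟩
        W j * fib (D j) * i j                                  ≈⟨ *-inv (den#0 j) ⟩
        1#                                                     ∎
        where
        regroup : ∀ f i w → f * i * w ≈ w * f * i
        regroup = solve 3 (λ f i w → f :* i :* w := w :* f :* i) refl

      e≈node : ∀ j → e j ≈ 1# * node s c p (toℕ j)
      e≈node j = sym (trans (*-identityˡ _) (*-cong (^-assocʳ z s (toℕ j)) (reflexive (≡.cong lucas (≡.sym (D≡ j))))))

      dividedSolution-interpolates : ∀ δ {f} → rising s 0 c ≈ 0# →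
        (∀ M → rising s (2 ℕ.+ M) c + z ^ (s ℕ.* c) * rising s M c
                 ≈ lucas (s ℕ.* c) * rising s (1 ℕ.+ M) c + δ * ((z ^ s) ^ suc M * rising s 1 c)) →
        (∀ N → f N ≈ δ * (1# * (z ^ s) ^ suc p) ^ suc N) →
        Interpolates s c p (dividedSolution e w (z ^ r) f)
      dividedSolution-interpolates δ R₀≈0 R-rec = interpolation s c δ R₀≈0 R-rec p 1# w-weights e≈node
        (sym (trans (*-congʳ (*-identityˡ 1#)) (*-identityˡ _)))

      T : ℕ → Carrier
      T = dividedSolution e w (z ^ r) (λ _ → 0#)

      partialFraction : ℤ → ℤ → Carrier
      partialFraction A B = ∑[ j < suc p ]
        ([-y]^ (pos (s ℕ.* toℕ j) ℤ.* A) * F (pos (D j) ℤ.* B)) / (W j * F (pos (D j))) [ den#0 j ]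

      r≡ : ∀ j → r ≡ s ℕ.* toℕ j ℕ.+ s ℕ.* toℕ j ℕ.+ D j
      r≡ j = ≡.trans (≡.cong (λ p → s ℕ.* (p ℕ.* 2 ℕ.+ c)) (≡.sym (ℕ.m∸n+n≡m (Fin.toℕ≤pred[n] j))))
        (≡.trans (+-*-Solver.solve 4 (λ s c d j → s ∶* ((d ∶+ j) ∶* con 2 ∶+ c)
                    ∶= s ∶* j ∶+ s ∶* j ∶+ s ∶* (d ∶* con 2 ∶+ c)) ≡.refl s c (p ∸ toℕ j) (toℕ j))
          (≡.cong (s ℕ.* toℕ j ℕ.+ s ℕ.* toℕ j ℕ.+_) (≡.sym (D≡ j))))
        where open +-*-Solver using (con) renaming (_:+_ to _∶+_; _:*_ to _∶*_; _:=_ to _∶=_)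

      u : Fin (suc p) → ℕ → Carrier
      u j = solution (e j) (z ^ r) (λ _ → 0#)

      u*fib : ∀ j N → u j (suc N) * fib (D j) ≈ z ^ (s ℕ.* toℕ j ℕ.* N) * fib (D j ℕ.* suc N)
      u*fib j N = trans
        (solution-fib a (D j)
          (trans (z^-≡ (r≡ j)) (trans (^-homo-* z (a ℕ.+ a) (D j)) (*-congʳ (^-homo-* z a a)))) N)
        (*-cong (^-assocʳ z a N) (fib-≡ (ℕ.*-comm (suc N) (D j))))
        where
        a : ℕ
        a = s ℕ.* toℕ j

      partialFraction-pos : ∀ N → partialFraction (pos N) (pos (suc N)) ≈ T (suc N)
      partialFraction-pos N = sum-cong-≋ term
        where
        term : ∀ j → [-y]^ (pos (s ℕ.* toℕ j) ℤ.* pos N) * F (pos (D j) ℤ.* pos (suc N)) * i j ≈ w j * u j (suc N)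
        term j = begin
          [-y]^ (pos (s ℕ.* toℕ j) ℤ.* pos N) * F (pos (D j) ℤ.* pos (suc N)) * i j
            ≈⟨ *-congʳ (*-cong (reflexive (≡.cong [-y]^_ (≡.sym (ℤ.pos-* (s ℕ.* toℕ j) N))))
                 (reflexive (≡.cong F (≡.sym (ℤ.pos-* (D j) (suc N)))))) ⟩
          z ^ (s ℕ.* toℕ j ℕ.* N) * fib (D j ℕ.* suc N) * i j
            ≈⟨ *-congʳ (u*fib j N) ⟨
          u j (suc N) * fib (D j) * i j
            ≈⟨ trans (*-assoc _ _ _) (*-comm _ _) ⟩
          w j * u j (suc N) ∎

      -- Every term of the sum is, up to a common factor, an odd function of the index.
      partialFraction-neg : ∀ N → T N ≈ 0# → partialFraction -[1+ N ] (ℤ.- pos N) ≈ 0#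
      partialFraction-neg N T≈0 = begin
        partialFraction -[1+ N ] (ℤ.- pos N)        ≈⟨ sum-cong-≋ (term N) ⟩
        sum (λ j → - (I ^ (r ℕ.* N)) * (w j * u j N)) ≈⟨ *-distribˡ-sum (- (I ^ (r ℕ.* N))) (λ j → w j * u j N) ⟨
        - (I ^ (r ℕ.* N)) * T N                     ≈⟨ trans (*-congˡ T≈0) (zeroʳ _) ⟩
        0#                                          ∎
        where
        I : Carrier
        I = inv z -y#0

        exponents : ∀ N j → [-y]^ (pos (s ℕ.* toℕ j) ℤ.* -[1+ N ]) * F (pos (D j) ℤ.* (ℤ.- pos N))
                      ≈ - (I ^ (s ℕ.* toℕ j ℕ.* suc N ℕ.+ D j ℕ.* N) * fib (D j ℕ.* N))
        exponents N j = begin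
          [-y]^ (pos a ℤ.* -[1+ N ]) * F (pos (D j) ℤ.* (ℤ.- pos N))
            ≈⟨ *-cong (reflexive (≡.cong [-y]^_ (neg a (suc N)))) (reflexive (≡.cong F (neg (D j) N))) ⟩
          [-y]^ (ℤ.- pos (a ℕ.* suc N)) * F (ℤ.- pos (D j ℕ.* N))
            ≈⟨ *-cong ([-y]^-neg (a ℕ.* suc N)) (F-neg (D j ℕ.* N)) ⟩
          I ^ (a ℕ.* suc N) * - (I ^ (D j ℕ.* N) * fib (D j ℕ.* N))
            ≈⟨ -‿distribʳ-* _ _ ⟨
          - (I ^ (a ℕ.* suc N) * (I ^ (D j ℕ.* N) * fib (D j ℕ.* N)))
            ≈⟨ -‿cong (trans (sym (*-assoc _ _ _)) (*-congʳ (sym (^-homo-* I (a ℕ.* suc N) (D j ℕ.* N))))) ⟩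
          - (I ^ (a ℕ.* suc N ℕ.+ D j ℕ.* N) * fib (D j ℕ.* N)) ∎
          where
          a : ℕ
          a = s ℕ.* toℕ j
          neg : ∀ m n → pos m ℤ.* (ℤ.- pos n) ≡ ℤ.- pos (m ℕ.* n)
          neg m n = ≡.trans (≡.sym (ℤ.neg-distribʳ-* (pos m) (pos n))) (≡.cong (ℤ.-_) (≡.sym (ℤ.pos-* m n)))

        rearrange : ∀ N j → I ^ (s ℕ.* toℕ j ℕ.* suc N ℕ.+ D j ℕ.* N) * fib (D j ℕ.* N) * i j
                              ≈ I ^ (r ℕ.* N) * (w j * u j N)
        rearrange zero j = trans (*-congʳ (trans (*-congˡ (fib-≡ (ℕ.*-zeroʳ (D j)))) (zeroʳ _)))
          (trans (zeroˡ _) (sym (trans (*-congˡ (zeroʳ _)) (zeroʳ _))))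
        -- `u*fib` requires the power z^n with n = sjN. Supplying it raises the exponent of the
        -- inverse to m + n = r(N+1), which is the same for all nodes.
        rearrange (suc N) j = begin
          I ^ m * f * i j                         ≈⟨ *-congʳ (*-congʳ (inv^*z^-cancel m n)) ⟨
          I ^ (m ℕ.+ n) * z ^ n * f * i j         ≈⟨ *-congʳ (*-congʳ (*-congʳ (reflexive (≡.cong (I ^_) m+n≡)))) ⟩
          I ^ (r ℕ.* suc N) * z ^ n * f * i j     ≈⟨ trans (*-congʳ (*-assoc _ _ _)) (*-assoc _ _ _) ⟩
          I ^ (r ℕ.* suc N) * (z ^ n * f * i j)   ≈⟨ *-congˡ (*-congʳ (u*fib j N)) ⟨
          I ^ (r ℕ.* suc N) * (u j (suc N) * fib (D j) * i j) ≈⟨ *-congˡ (trans (*-assoc _ _ _) (*-comm _ _)) ⟩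
          I ^ (r ℕ.* suc N) * (w j * u j (suc N)) ∎
          where
          open +-*-Solver using (con) renaming (_:+_ to _∶+_; _:*_ to _∶*_; _:=_ to _∶=_)
          m n : ℕ
          m = s ℕ.* toℕ j ℕ.* (2 ℕ.+ N) ℕ.+ D j ℕ.* suc N
          n = s ℕ.* toℕ j ℕ.* N
          f : Carrier
          f = fib (D j ℕ.* suc N)
          m+n≡ : m ℕ.+ n ≡ r ℕ.* suc N
          m+n≡ = ≡.trans (+-*-Solver.solve 3 (λ a d N → a ∶* (con 2 ∶+ N) ∶+ d ∶* (con 1 ∶+ N) ∶+ a ∶* N
                   ∶= (a ∶+ a ∶+ d) ∶* (con 1 ∶+ N)) ≡.refl (s ℕ.* toℕ j) (D j) N)
                 (≡.cong (ℕ._* suc N) (≡.sym (r≡ j)))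

        term : ∀ N j → [-y]^ (pos (s ℕ.* toℕ j) ℤ.* -[1+ N ]) * F (pos (D j) ℤ.* (ℤ.- pos N)) * i j
                         ≈ - (I ^ (r ℕ.* N)) * (w j * u j N)
        term N j = trans (*-congʳ (exponents N j)) (trans (sym (-‿distribˡ-* _ _))
          (trans (-‿cong (rearrange N j)) (-‿distribˡ-* _ _)))

      module _ (k : ℕ) where

        shiftedFraction : ℕ → Carrier
        shiftedFraction m = partialFraction (pos m ℤ.- pos k) (pos (m ℕ.+ 1) ℤ.- pos k)

        shiftedFraction-high : ∀ N → shiftedFraction (N ℕ.+ k) ≈ T (suc N)
        shiftedFraction-high N = trans (reflexive (≡.cong₂ partialFraction (difference N)
          (≡.trans (≡.cong (λ m → pos m ℤ.- pos k) (ℕ.+-comm (N ℕ.+ k) 1)) (difference (suc N)))))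
          (partialFraction-pos N)
          where
          difference : ∀ N → pos (N ℕ.+ k) ℤ.- pos k ≡ pos N
          difference N = ≡.trans (ℤ.m-n≡m⊖n (N ℕ.+ k) k)
            (≡.trans (ℤ.⊖-≥ (ℕ.m≤n+m k N)) (≡.cong pos (ℕ.m+n∸n≡m N k)))

        -- Here the hypothesis p ≥ k of the theorem enters: it keeps N = k-m-1 within the range
        -- where `T` vanishes.
        shiftedFraction-low : k ≤ suc p → (∀ N → N ≤ p → T N ≈ 0#) → ∀ {m} → m < k → shiftedFraction m ≈ 0#
        shiftedFraction-low k≤1+p T≈0 {m} m<k = trans (reflexive (≡.cong₂ partialFraction A≡ B≡))
          (partialFraction-neg N (T≈0 N N≤p))
          where
          N : ℕ
          N = k ∸ suc m
          N≤p : N ≤ p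
          N≤p = ℕ.∸-mono {v = 1} k≤1+p (s≤s z≤n)
          A≡ : pos m ℤ.- pos k ≡ -[1+ N ]
          A≡ = ≡.trans (ℤ.m-n≡m⊖n m k) (≡.trans (ℤ.⊖-< m<k) (≡.cong (λ n → ℤ.- pos n) (ℕ.+-∸-assoc 1 m<k)))
          B≡ : pos (m ℕ.+ 1) ℤ.- pos k ≡ ℤ.- pos N
          B≡ = ≡.trans (≡.cong (λ n → pos n ℤ.- pos k) (ℕ.+-comm m 1))
            (≡.trans (ℤ.m-n≡m⊖n (suc m) k) (ℤ.⊖-≤ m<k))

  -- The two identities over an arbitrary Heyting field.

  n<k⇒n+1+p∸k≤p : ∀ {n k p} → n < k → n ℕ.+ suc p ∸ k ≤ p
  n<k⇒n+1+p∸k≤p {n} {p = p} n<k = ℕ.≤-trans (ℕ.∸-monoʳ-≤ (n ℕ.+ suc p) n<k)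
    (ℕ.≤-reflexive (≡.trans (≡.cong (_∸ suc n) (ℕ.+-suc n p)) (ℕ.m+n∸m≡n n p)))

  module _ (s : ℕ) where

    -- For c = 1 the base case concerns the single factor F_{sM}. Its recurrence, `lucas*fib`, is
    -- homogeneous, so δ = 0.
    interpolates-odd : ∀ {p} D D≡ den#0 → let open PartialFractions s 1 p D D≡ in Interpolates s 1 p (T den#0)
    interpolates-odd D D≡ den#0 = dividedSolution-interpolates den#0 0# (rising₀ s 0) R-rec (λ _ → sym (zeroˡ _))
      where
      open PartialFractions s 1 _ D D≡
      open +-*-Solver using (con) renaming (_:+_ to _∶+_; _:*_ to _∶*_; _:=_ to _∶=_)
      index₁ : ∀ M → s ℕ.* (2 ℕ.+ M ℕ.+ 0) ≡ s ℕ.* 1 ℕ.+ (s ℕ.* 1 ℕ.+ s ℕ.* M)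
      index₁ = +-*-Solver.solve 2 (λ s M → s ∶* (con 2 ∶+ M ∶+ con 0) ∶= s ∶* con 1 ∶+ (s ∶* con 1 ∶+ s ∶* M)) ≡.refl s
      index₂ : ∀ M → s ℕ.* 1 ℕ.+ s ℕ.* M ≡ s ℕ.* (1 ℕ.+ M ℕ.+ 0)
      index₂ = +-*-Solver.solve 2 (λ s M → s ∶* con 1 ∶+ s ∶* M ∶= s ∶* (con 1 ∶+ M ∶+ con 0)) ≡.refl s
      R-rec : ∀ M → rising s (2 ℕ.+ M) 1 + z ^ (s ℕ.* 1) * rising s M 1
                      ≈ lucas (s ℕ.* 1) * rising s (1 ℕ.+ M) 1 + 0# * ((z ^ s) ^ suc M * rising s 1 1)
      R-rec M = begin
        rising s (2 ℕ.+ M) 1 + z ^ (s ℕ.* 1) * rising s M 1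
          ≈⟨ +-cong (trans (*-identityʳ _) (fib-≡ (index₁ M)))
               (*-congˡ (trans (*-identityʳ _) (fib-≡ (≡.cong (s ℕ.*_) (ℕ.+-identityʳ M))))) ⟩
        fib (s ℕ.* 1 ℕ.+ (s ℕ.* 1 ℕ.+ s ℕ.* M)) + z ^ (s ℕ.* 1) * fib (s ℕ.* M)
          ≈⟨ lucas*fib (s ℕ.* 1) (s ℕ.* M) ⟩
        lucas (s ℕ.* 1) * fib (s ℕ.* 1 ℕ.+ s ℕ.* M)
          ≈⟨ *-congˡ (trans (*-identityʳ _) (fib-≡ (≡.sym (index₂ M)))) ⟨
        lucas (s ℕ.* 1) * rising s (1 ℕ.+ M) 1
          ≈⟨ trans (+-congˡ (zeroˡ _)) (+-identityʳ _) ⟨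
        lucas (s ℕ.* 1) * rising s (1 ℕ.+ M) 1 + 0# * ((z ^ s) ^ suc M * rising s 1 1) ∎

    -- For c = 2 the base case is `rising-recurrence` at k = 0. It leaves the term q^(M+1) F_s
    -- F_{2s}, so δ = 1; this is the origin of the geometric inhomogeneity.
    interpolates-even : ∀ {p} D D≡ den#0 → let open PartialFractions s 2 p D D≡ in
      Interpolates s 2 p (dividedSolution e (w den#0) (z ^ r den#0) (λ N → (z ^ (s ℕ.* suc p)) ^ suc N))
    interpolates-even {p} D D≡ den#0 = dividedSolution-interpolates den#0 1# (rising₀ s 1) R-rec
      (λ N → trans (^-congˡ (suc N) (sym (trans (*-identityˡ _) (^-assocʳ z s (suc p))))) (sym (*-identityˡ _)))
      where
      open PartialFractions s 2 p D D≡
      R-rec : ∀ M → rising s (2 ℕ.+ M) 2 + z ^ (s ℕ.* 2) * rising s M 2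
                      ≈ lucas (s ℕ.* 2) * rising s (1 ℕ.+ M) 2 + 1# * ((z ^ s) ^ suc M * rising s 1 2)
      R-rec M = trans (rising-recurrence s 0 M) (+-congˡ (trans
        (*-cong (sym (^-assocʳ z s (suc M))) (regroup _ _ _)) (sym (*-identityˡ _))))
        where
        regroup : ∀ a b t → a * b * t ≈ b * (a * t)
        regroup = solve 3 (λ a b t → a :* b :* t := b :* (a :* t)) refl

    fibopoly-odd : ∀ {k p} D D≡ den#0 n k#0 → k ≤ suc p →
      fibopoly s (n ℕ.+ suc p ∸ k) (2 ℕ.* suc p ∸ 1) k#0 ≈ PartialFractions.shiftedFraction s 1 p D D≡ den#0 k n
    fibopoly-odd {k} {p} D D≡ den#0 n k#0 k≤1+p with k ℕ.≤? n
    ... | no k≰n = trans (fibopoly-zero s _ k#0 n+1+p∸k<) (sym (shiftedFraction-low den#0 k k≤1+p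
                     (proj₁ (interpolates-odd D D≡ den#0)) n<k))
      where
      open PartialFractions s 1 p D D≡
      n<k : n < k
      n<k = ℕ.≰⇒> k≰n
      n+1+p∸k< : n ℕ.+ suc p ∸ k < 2 ℕ.* suc p ∸ 1
      n+1+p∸k< = ℕ.≤-<-trans (n<k⇒n+1+p∸k≤p n<k) (ℕ.m<m+n p ℕ.z<s)
    ... | yes k≤n with n ∸ k | ℕ.m∸n+n≡m k≤n
    ...   | N | ≡.refl = trans
      (fibopoly-interpolates s _ _ (suc N) k#0 (interpolates-odd D D≡ den#0) index₁ index₂)
      (sym (shiftedFraction-high den#0 k N))
      where
      open PartialFractions s 1 p D D≡
      open +-*-Solver using (con) renaming (_:+_ to _∶+_; _:*_ to _∶*_; _:=_ to _∶=_)
      index₁ : 2 ℕ.* suc p ∸ 1 ≡ p ℕ.* 2 ℕ.+ 1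
      index₁ = +-*-Solver.solve 1 (λ p → p ∶+ (con 1 ∶+ (p ∶+ con 0)) ∶= p ∶* con 2 ∶+ con 1) ≡.refl p
      index₂ : suc (N ℕ.+ k ℕ.+ suc p ∸ k) ≡ suc N ℕ.+ p ℕ.+ 1
      index₂ = ≡.cong suc (≡.trans (≡.cong (_∸ k)
        (+-*-Solver.solve 3 (λ N k p → N ∶+ k ∶+ (con 1 ∶+ p) ∶= (N ∶+ p ∶+ con 1) ∶+ k) ≡.refl N k p))
        (ℕ.m+n∸n≡m (N ℕ.+ p ℕ.+ 1) k))

    -- Without its term t = 0, the convolution is h times the preceding one.
    ∗-geometric : ∀ {a b : ℕ → Carrier} h → a 0 ≈ 1# → (∀ m → a (suc m) ≈ h * a m) → ∀ n →
                  (a ∗ b) (suc n) ≈ h * (a ∗ b) n + b (suc n)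
    ∗-geometric {a} {b} h a₀≈1 a-rec n = trans (+-comm _ _) (+-cong
      (trans (sum-cong-≋ {suc n} (λ t → trans (*-congʳ (a-rec (toℕ t))) (*-assoc h (a (toℕ t)) (b (n ∸ toℕ t)))))
        (sym (*-distribˡ-sum {suc n} h (λ t → a (toℕ t) * b (n ∸ toℕ t)))))
      (trans (*-congʳ a₀≈1) (*-identityˡ _)))

    -- The convolution at N + k and `C` at N + 1 obey the same first-order recursion, so only their
    -- starting values need comparison.
    fibopoly-even : ∀ {k p} D D≡ den#0 n k#0 .{{_ : NonZero k}} → k ≤ suc p →
      fibopoly s (n ℕ.+ suc p ℕ.+ 1 ∸ k) (2 ℕ.* suc p) k#0
        ≈ ((λ m → [-y]^ pos (s ℕ.* suc p ℕ.* m)) ∗ PartialFractions.shiftedFraction s 2 p D D≡ den#0 k) n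
    fibopoly-even {suc k-1} {p} D D≡ den#0 n k#0 k≤1+p = result
      where
      open PartialFractions s 2 p D D≡
      k : ℕ
      k = suc k-1
      h : Carrier
      h = z ^ (s ℕ.* suc p)
      a b C : ℕ → Carrier
      a m = [-y]^ pos (s ℕ.* suc p ℕ.* m)
      b = shiftedFraction den#0 k
      C = dividedSolution e (w den#0) (z ^ r den#0) (λ N → h ^ suc N)

      C-interpolates : Interpolates s 2 p C
      C-interpolates = interpolates-even D D≡ den#0

      C-rec : ∀ N → C (suc N) ≈ h * C N + T den#0 (suc N)
      C-rec = dividedSolution-geometric e (w den#0) (z ^ r den#0) h

      C₀≈0 : C 0 ≈ 0#
      C₀≈0 = proj₁ C-interpolates 0 z≤n

      -- For c = 2 `interpolation` describes the inhomogeneous `C`; the homogeneous `T` is recovered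
      -- as C (N+1) - h C N.
      T≈0 : ∀ N → N ≤ p → T den#0 N ≈ 0#
      T≈0 zero    _   = dividedSolution₀ e (w den#0) (z ^ r den#0) (λ _ → 0#)
      T≈0 (suc N) N<p = begin
        T den#0 (suc N)            ≈⟨ +-identityˡ _ ⟨
        0# + T den#0 (suc N)       ≈⟨ +-congʳ (trans (*-congˡ (proj₁ C-interpolates N (ℕ.<⇒≤ N<p))) (zeroʳ h)) ⟨
        h * C N + T den#0 (suc N)  ≈⟨ C-rec N ⟨
        C (suc N)                  ≈⟨ proj₁ C-interpolates (suc N) N<p ⟩
        0#                         ∎

      b-low : ∀ {m} → m < k → b m ≈ 0#
      b-low = shiftedFraction-low den#0 k k≤1+p T≈0

      ∗-rec : ∀ n → (a ∗ b) (suc n) ≈ h * (a ∗ b) n + b (suc n)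
      ∗-rec = ∗-geometric {b = b} h (z^-≡ (ℕ.*-zeroʳ (s ℕ.* suc p)))
        (λ m → trans (z^-≡ (ℕ.*-suc (s ℕ.* suc p) m)) (^-homo-* z (s ℕ.* suc p) (s ℕ.* suc p ℕ.* m)))

      ∗-low : ∀ n → n < k → (a ∗ b) n ≈ 0#
      ∗-low zero    0<k = trans (+-identityʳ _) (trans (*-congˡ (b-low 0<k)) (zeroʳ _))
      ∗-low (suc n) n<k = trans (∗-rec n) (trans
        (+-cong (trans (*-congˡ (∗-low n (ℕ.<⇒≤ n<k))) (zeroʳ h)) (b-low n<k)) (+-identityˡ 0#))

      ∗-high : ∀ N → (a ∗ b) (N ℕ.+ k) ≈ C (suc N)
      -- As k ≥ 1, the index k-1 exists; the convolution is zero there, as is `C 0`.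
      ∗-high zero    = trans (∗-rec k-1) (trans
        (+-cong (*-congˡ (trans (∗-low k-1 ℕ.≤-refl) (sym C₀≈0))) (shiftedFraction-high den#0 k 0)) (sym (C-rec 0)))
      ∗-high (suc N) = trans (∗-rec (N ℕ.+ k)) (trans
        (+-cong (*-congˡ (∗-high N)) (shiftedFraction-high den#0 k (suc N))) (sym (C-rec (suc N))))

      result : fibopoly s (n ℕ.+ suc p ℕ.+ 1 ∸ k) (2 ℕ.* suc p) k#0 ≈ (a ∗ b) n
      result with k ℕ.≤? n
      ... | no k≰n = trans (fibopoly-zero s _ k#0 index) (sym (∗-low n n<k))
        where
        n<k : n < k
        n<k = ℕ.≰⇒> k≰n
        index : n ℕ.+ suc p ℕ.+ 1 ∸ k < 2 ℕ.* suc p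
        index = ℕ.≤-<-trans
          (ℕ.≤-trans (ℕ.≤-reflexive (≡.cong (_∸ k) (≡.trans (ℕ.+-assoc n (suc p) 1) (≡.cong (n ℕ.+_) (ℕ.+-comm (suc p) 1)))))
            (n<k⇒n+1+p∸k≤p n<k))
          (ℕ.m<m+n (suc p) ℕ.z<s)
      ... | yes k≤n with n ∸ k | ℕ.m∸n+n≡m k≤n
      ...   | N | ≡.refl = trans
        (fibopoly-interpolates s _ _ (suc N) k#0 C-interpolates index₁ index₂) (sym (∗-high N))
        where
        open +-*-Solver using (con) renaming (_:+_ to _∶+_; _:*_ to _∶*_; _:=_ to _∶=_)
        index₁ : 2 ℕ.* suc p ≡ p ℕ.* 2 ℕ.+ 2
        index₁ = +-*-Solver.solve 1 (λ p → con 2 ∶* (con 1 ∶+ p) ∶= p ∶* con 2 ∶+ con 2) ≡.refl p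
        index₂ : suc (N ℕ.+ k ℕ.+ suc p ℕ.+ 1 ∸ k) ≡ suc N ℕ.+ p ℕ.+ 2
        index₂ = ≡.cong suc (≡.trans (≡.cong (_∸ k)
          (+-*-Solver.solve 3 (λ N k p → N ∶+ k ∶+ (con 1 ∶+ p) ∶+ con 1 ∶= (N ∶+ p ∶+ con 2) ∶+ k) ≡.refl N k p))
          (ℕ.m+n∸n≡m (N ℕ.+ p ℕ.+ 2) k))

  -- Apartness of the denominators is a hypothesis here, so x and y can be arbitrary elements with
  -- -y apart from 0 and no degree argument is involved.
  identities : ∀ (s k p : ℕ) .{{_ : NonZero k}} .{{_ : NonZero p}} → k ≤ p → (n : ℕ) →
    (even#0 : (∏[ i < 2 ℕ.* p ] F (pos (s ℕ.* suc (toℕ i)))) # 0#)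
    (odd#0 : (∏[ i < 2 ℕ.* p ∸ 1 ] F (pos (s ℕ.* suc (toℕ i)))) # 0#)
    (𝒫*F#0 : ∀ j → (𝒫 s p j * F (pos (2 ℕ.* s ℕ.* (p ∸ toℕ j)))) # 0#)
    (ℛ*F#0 : ∀ j → (ℛ s p j * F (pos (s ℕ.* (2 ℕ.* p ∸ 1 ∸ 2 ℕ.* toℕ j)))) # 0#) →
    (fibopoly s (n ℕ.+ p ℕ.+ 1 ∸ k) (2 ℕ.* p) even#0
      ≈ ((λ m → [-y]^ pos (s ℕ.* p ℕ.* m))
          ∗ (λ m → ∑[ j < p ]
              ([-y]^ (pos (s ℕ.* toℕ j) ℤ.* (pos m ℤ.- pos k))
                * F (pos (2 ℕ.* s ℕ.* (p ∸ toℕ j)) ℤ.* (pos (m ℕ.+ 1) ℤ.- pos k)))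
              / (𝒫 s p j * F (pos (2 ℕ.* s ℕ.* (p ∸ toℕ j)))) [ 𝒫*F#0 j ])) n)
    ×
    (fibopoly s (n ℕ.+ p ∸ k) (2 ℕ.* p ∸ 1) odd#0
      ≈ ∑[ j < p ]
          ([-y]^ (pos (s ℕ.* toℕ j) ℤ.* (pos n ℤ.- pos k))
            * F (pos (s ℕ.* (2 ℕ.* p ∸ 1 ∸ 2 ℕ.* toℕ j)) ℤ.* (pos (n ℕ.+ 1) ℤ.- pos k)))
          / (ℛ s p j * F (pos (s ℕ.* (2 ℕ.* p ∸ 1 ∸ 2 ℕ.* toℕ j)))) [ ℛ*F#0 j ])
  identities s k (suc p) k≤p n even#0 odd#0 𝒫*F#0 ℛ*F#0 =
    fibopoly-even s (λ j → 2 ℕ.* s ℕ.* (suc p ∸ toℕ j)) (even-index s p) 𝒫*F#0 n even#0 k≤p ,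
    fibopoly-odd s (λ j → s ℕ.* (2 ℕ.* suc p ∸ 1 ∸ 2 ℕ.* toℕ j)) (odd-index s p) ℛ*F#0 n odd#0 k≤p

corollary17 : ∀ {c ℓ₁ ℓ₂} (K : HeytingField c ℓ₁ ℓ₂) →
  let open RationalFunctions K in
  ∀ (s k p : ℕ) .{{_ : NonZero s}} .{{_ : NonZero k}} .{{_ : NonZero p}} → k ≤ p → (n : ℕ) →
  (fibopolynomial s (n ℕ.+ p ℕ.+ 1 ∸ k) (2 ℕ.* p)
    ≈ ((λ m → [-y]^ pos (s ℕ.* p ℕ.* m))
        ∗ (λ m → ∑[ j < p ]
            ([-y]^ (pos (s ℕ.* toℕ j) ℤ.* (pos m ℤ.- pos k))
              * F (pos (2 ℕ.* s ℕ.* (p ∸ toℕ j)) ℤ.* (pos (m ℕ.+ 1) ℤ.- pos k)))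
            / (𝒫 s p j * F (pos (2 ℕ.* s ℕ.* (p ∸ toℕ j)))) [ 𝒫*F#0 s p j ])) n)
  ×
  (fibopolynomial s (n ℕ.+ p ∸ k) (2 ℕ.* p ∸ 1)
    ≈ ∑[ j < p ]
        ([-y]^ (pos (s ℕ.* toℕ j) ℤ.* (pos n ℤ.- pos k))
          * F (pos (s ℕ.* (2 ℕ.* p ∸ 1 ∸ 2 ℕ.* toℕ j)) ℤ.* (pos (n ℕ.+ 1) ℤ.- pos k)))
        / (ℛ s p j * F (pos (s ℕ.* (2 ℕ.* p ∸ 1 ∸ 2 ℕ.* toℕ j)))) [ ℛ*F#0 s p j ])
-- The underscores matter: unification copies x, y and the apartness proofs verbatim from the goal, whereas
-- comparing them with any other expression for them unfolds the arithmetic of K(x,y).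
corollary17 K s k p k≤p n =
  FibonacciInterpolation.identities (Fractions.fractionField _) _ _ _ s k p k≤p n _ _ _ _
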